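{- If $G$ is a $3$-edge-connected graph with $n$ vertices, then $G$ has at least $2^{n/7}$ nowhere-zero $\mathbb{Z}_2\times \mathbb{Z}_3$-flows.
   Context: Graphs are finite and may have loops and parallel edges. Given an orientation of the edges of $G$ and an abelian group $\Gamma$, a $\Gamma$-flow is a map $\phi:E(G)\to\Gamma$ such that for every vertex $v$, $\sum_{e\in\delta^+(v)}\phi(e)=\sum_{e\in\delta^-(v)}\phi(e)$, where $\delta^+(v)$, $\delta^-(v)$ are the sets of edges directed away from / towards $v$. It is nowhere-zero if $\phi(e)\neq 0$ for all edges $e$. (The number of nowhere-zero $\Gamma$-flows does not depend on the chosen orientation, since reversing an edge and negating its value preserves the flow condition.) -}

module Defs where

open import Data.Nat using (ℕ; zero; suc; _+_; _%_; _≤_)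
open import Data.Fin using (Fin; toℕ; fromℕ<)
open import Data.Fin.Properties using () renaming (_≟_ to _≟ᶠ_)
open import Data.Nat.DivMod using (m%n<n)
open import Data.Product using (_×_; _,_; proj₁; proj₂; ∃; Σ)
open import Data.Vec using (Vec; lookup)
open import Data.List using (List; foldr; filter)
open import Data.Fin.Subset using (Subset; _∈_; _∉_)
open import Data.List using (length; allFin)
open import Relation.Binary.PropositionalEquality using (_≡_)
open import Relation.Nullary using (¬_; Dec; yes; no)

-- Graphs with loops and parallel edges: n vertices (Fin n), m edges
-- (Fin m); edge e is oriented from  tail e  to  head e.

record Graph : Set where
  field
    n    : ℕ
    m    : ℕ
    tail : Fin m → Fin n
    head : Fin m → Fin n
open Graph public

addMod : ∀ {k} → Fin (suc k) → Fin (suc k) → Fin (suc k)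
addMod {k} a b = fromℕ< (m%n<n (toℕ a + toℕ b) (suc k))

Z2×Z3 : Set
Z2×Z3 = Fin 2 × Fin 3

0G : Z2×Z3
0G = Fin.zero , Fin.zero

_⊕_ : Z2×Z3 → Z2×Z3 → Z2×Z3
(a , b) ⊕ (c , d) = addMod a c , addMod b d

sumOver : ∀ {m} → (P : Fin m → Set) → (∀ e → Dec (P e)) → (Fin m → Z2×Z3) → Z2×Z3
sumOver {m} P P? φ = foldr (λ e acc → add e acc) 0G (allFin m)
  where
  add : Fin m → Z2×Z3 → Z2×Z3
  add e acc with P? e
  ... | yes _ = φ e ⊕ acc
  ... | no  _ = acc

-- A Z2×Z3-assignment is stored as a vector of edge values (so that
-- distinctness of assignments is decidable/pointwise).
Assignment : Graph → Set
Assignment G = Vec Z2×Z3 (m G)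

IsFlow : (G : Graph) → Assignment G → Set
IsFlow G φ = ∀ (v : Fin (n G)) →
  sumOver (λ e → tail G e ≡ v) (λ e → tail G e ≟ᶠ v) (lookup φ)
    ≡ sumOver (λ e → head G e ≡ v) (λ e → head G e ≟ᶠ v) (lookup φ)

NowhereZero : (G : Graph) → Assignment G → Set
NowhereZero G φ = ∀ (e : Fin (m G)) → ¬ (lookup φ e ≡ 0G)

IsNZFlow : (G : Graph) → Assignment G → Set
IsNZFlow G φ = IsFlow G φ × NowhereZero G φ

Crosses : (G : Graph) → Subset (n G) → Fin (m G) → Set
Crosses G S e = (tail G e ∈ S × head G e ∉ S) ⊎' (tail G e ∉ S × head G e ∈ S)
  where open import Data.Sum using () renaming (_⊎_ to _⊎'_)

Crosses? : (G : Graph) → (S : Subset (n G)) → ∀ e → Dec (Crosses G S e)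
Crosses? G S e = (tail G e ∈? S ×-dec ¬? (head G e ∈? S)) ⊎-dec (¬? (tail G e ∈? S) ×-dec head G e ∈? S)
  where
  open import Data.Fin.Subset.Properties using (_∈?_)
  open import Relation.Nullary using (¬?)
  open import Relation.Nullary.Decidable using (_×-dec_; _⊎-dec_)

cutSize : (G : Graph) → Subset (n G) → ℕ
cutSize G S = length (filter (Crosses? G S) (allFin (m G)))

EdgeConnected : ℕ → Graph → Set
EdgeConnected k G =
  2 ≤ n G ×
  (∀ (S : Subset (n G)) → ∃ (λ v → v ∈ S) → ∃ (λ v → v ∉ S) → k ≤ cutSize G S)

{-# OPTIONS --safe #-}
module Submission where

-- It suffices to find Z2×Z3-flows f and F such that F only takes the values 0 and ±(1,1), and the
-- Z3-part of f is nonzero wherever F vanishes; this is Seymour's 6-flow theorem with an Eulerian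
-- orientation of the even subgraph C = supp F.  Among the Z3-parts of f, f + F and f − F, each
-- vanishing only inside C and each edge of C being a zero of exactly one of them, some one has a
-- zero set Z with 3|Z| ≤ |C|.  Combining it with any Z2-flow equal to 1 on Z gives a nowhere-zero
-- flow.  As 1_C is such a Z2-flow, pigeonhole over the boundary (n bits) and the restriction to Z
-- gives at least 2^(m − n − |Z|) of them.  Since degrees are at least 3 and C is even,
-- 7 + deg_C(v) ≤ 3 deg(v) for each vertex v, hence 7n + 6|Z| ≤ 7n + 2|C| ≤ 6m.
--
-- The pair f, F is built by growing the set U of vertices still to be treated as one: a minimal set
-- L outside U with at most one edge to the rest of the complement of U is 2-edge-connected and sends
-- two edges to U, and some closed trail in L meets both of them.  Absorbing the trail into U, F runs
-- along it, the two edges are used to balance f on the trail as a whole, and the trail itself is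
-- used to balance f at each of its vertices.

open import Defs
open import Data.Nat using (ℕ; _≤_; _^_)
open import Data.List using (List; length)
open import Data.List.Relation.Unary.All using (All)
open import Data.List.Relation.Unary.Unique.Propositional using (Unique)
open import Data.Product using (Σ; _×_)

open import Algebra.Bundles using (CommutativeMonoid)
open import Data.Bool using (Bool; true; false)
open import Data.Fin using (Fin; zero; suc; toℕ; fromℕ<)
open import Data.Fin.Patterns using (0F; 1F; 2F)
open import Data.Fin.Properties using (all?; any?) renaming (_≟_ to _≟ᶠ_)
open import Data.Fin.Subset using (Subset; Nonempty; _∈_; _∉_; _⊆_; _⊂_; _⊃_; _∪_; _∩_; ∁; ⁅_⁆; ⊥)
open import Data.Fin.Subset.Induction using (⊂-wellFounded; ⊃-wellFounded)
open import Data.Fin.Subset.Properties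
  using ( _∈?_; _⊆?_; _⊂?_; nonempty?; anySubset?; ∉⊥; x∈⁅x⁆; x∈⁅y⁆⇒x≡y; p⊆p∪q; x∈p∪q⁺; x∈p∪q⁻
        ; p∩q⊆p; x∈p∩q⁺; x∈p∩q⁻; x∈∁p⇒x∉p; x∉∁p⇒x∈p; x∉p⇒x∈∁p)
open import Data.List using ([]; _∷_; _++_; map; filter; foldr; allFin; tabulate; cartesianProductWith)
open import Data.List.Membership.DecPropositional using () renaming (_∈?_ to member?)
open import Data.List.Membership.Propositional using () renaming (_∈_ to _∈ˡ_; _∉_ to _∉ˡ_)
open import Data.List.Membership.Propositional.Properties
  using (∈-++⁺ˡ; ∈-++⁺ʳ; ∈-++⁻; ∈-map⁺; ∈-filter⁺; ∈-filter⁻; ∈-allFin)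
open import Data.List.Properties using (length-map; length-++; length-tabulate)
open import Data.List.Relation.Unary.All using ([]; _∷_)
import Data.List.Relation.Unary.All as All
import Data.List.Relation.Unary.All.Properties as Allₚ
open import Data.List.Relation.Unary.AllPairs using ([]; _∷_)
open import Data.List.Relation.Unary.Any using (here; there)
import Data.List.Relation.Unary.Unique.Propositional.Properties as Uniqueₚ
open import Data.Nat using (_+_; _*_; s≤s; z≤n; _≤?_)
open import Data.Nat.Properties
  using ( +-0-commutativeMonoid; +-comm; +-identityʳ; +-suc; *-comm; *-assoc; *-identityʳ; *-zeroʳ; *-distribˡ-+
        ; [m*n]*[o*p]≡[m*o]*[n*p]
        ; ≤-refl; ≤-reflexive; ≤-trans; ≤-antisym; ≤-total; ≤-pred; ≰⇒>; <-irrefl; n≤1+n; m≤m+n; m≤n+m; m≤n*m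
        ; +-mono-≤; +-monoˡ-≤; +-monoʳ-≤; +-mono-<; *-monoʳ-≤; *-cancelˡ-≤
        ; ^-distribˡ-+-*; ^-*-assoc; ^-monoˡ-≤; ^-monoʳ-≤; m^n≢0; module ≤-Reasoning)
open import Data.Nat.Tactic.RingSolver using (solve-∀)
open import Data.Product using (_,_; proj₁; proj₂; ∃; ∃₂)
open import Data.Sum as Sum using (_⊎_; inj₁; inj₂)
open import Data.Vec as Vec using (Vec; []; _∷_; lookup)
open import Data.Vec.Properties
  using ([]=⇒lookup; lookup⇒[]=; lookup∘tabulate; tabulate∘lookup; tabulate-cong; ∷-injective)
open import Function using (_∘_; id)
open import Induction.WellFounded using (Acc; acc)
open import Level using (0ℓ)
open import Relation.Binary.PropositionalEquality
  using (_≡_; _≢_; refl; sym; trans; cong; cong₂; subst; subst₂; isEquivalence; module ≡-Reasoning)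
open import Relation.Nullary using (¬_; Dec; yes; no; does; contradiction)
open import Relation.Nullary.Decidable
  using (¬?; _×-dec_; _⊎-dec_; _→-dec_; decidable-stable; from-yes; dec-true; dec-false)

import Algebra.Properties.CommutativeMonoid.Sum +-0-commutativeMonoid as ℕΣ

-- Arithmetic of `Z2×Z3`.

Γ : Set
Γ = Z2×Z3

-- Every element of Z2 is its own inverse, and in Z3 the double of an element is its negative.
neg : Γ → Γ
neg (a , b) = a , addMod b b

-- Like the other group laws, this is decided by running through all values, one coordinate at a
-- time.
⊕-assoc : ∀ a b c → (a ⊕ b) ⊕ c ≡ a ⊕ (b ⊕ c)
⊕-assoc (a , x) (b , y) (c , z) = cong₂ _,_
  (from-yes (all? λ a → all? λ b → all? λ c → addMod (addMod a b) c ≟ᶠ addMod {1} a (addMod b c)) a b c)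
  (from-yes (all? λ a → all? λ b → all? λ c → addMod (addMod a b) c ≟ᶠ addMod {2} a (addMod b c)) x y z)

⊕-comm : ∀ a b → a ⊕ b ≡ b ⊕ a
⊕-comm (a , x) (b , y) = cong₂ _,_
  (from-yes (all? λ a → all? λ b → addMod a b ≟ᶠ addMod {1} b a) a b)
  (from-yes (all? λ a → all? λ b → addMod a b ≟ᶠ addMod {2} b a) x y)

⊕-identityˡ : ∀ a → 0G ⊕ a ≡ a
⊕-identityˡ (a , x) = cong₂ _,_
  (from-yes (all? λ a → addMod {1} 0F a ≟ᶠ a) a)
  (from-yes (all? λ a → addMod {2} 0F a ≟ᶠ a) x)

⊕-identityʳ : ∀ a → a ⊕ 0G ≡ a
⊕-identityʳ a = trans (⊕-comm a 0G) (⊕-identityˡ a)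

⊕-inverseʳ : ∀ a → a ⊕ neg a ≡ 0G
⊕-inverseʳ (a , x) = cong₂ _,_
  (from-yes (all? λ a → addMod {1} a a ≟ᶠ 0F) a)
  (from-yes (all? λ a → addMod {2} a (addMod a a) ≟ᶠ 0F) x)

⊕-commutativeMonoid : CommutativeMonoid 0ℓ 0ℓ
⊕-commutativeMonoid = record
  { Carrier = Γ ; _≈_ = _≡_ ; _∙_ = _⊕_ ; ε = 0G
  ; isCommutativeMonoid = record
    { isMonoid = record
      { isSemigroup = record
        { isMagma = record { isEquivalence = isEquivalence ; ∙-cong = cong₂ _⊕_ }
        ; assoc = ⊕-assoc }
      ; identity = ⊕-identityˡ , ⊕-identityʳ }
    ; comm = ⊕-comm } }

open import Algebra.Properties.CommutativeMonoid.Sum ⊕-commutativeMonoid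
  using (sum; sum-cong-≗; ∑-distrib-+; ∑-comm; sum-replicate-zero)
open import Algebra.Properties.CommutativeSemigroup (CommutativeMonoid.commutativeSemigroup ⊕-commutativeMonoid)
  using (interchange)

neg-⊕ : ∀ a b → neg (a ⊕ b) ≡ neg a ⊕ neg b
neg-⊕ (a , x) (b , y) = cong (addMod a b ,_)
  (from-yes (all? λ x → all? λ y →
     addMod (addMod x y) (addMod x y) ≟ᶠ addMod {2} (addMod x x) (addMod y y)) x y)

neg-involutive : ∀ a → neg (neg a) ≡ a
neg-involutive (a , x) = cong (a ,_) (from-yes (all? λ x → addMod (addMod {2} x x) (addMod x x) ≟ᶠ x) x)

⊕-inverseˡ : ∀ a → neg a ⊕ a ≡ 0G
⊕-inverseˡ a = trans (⊕-comm (neg a) a) (⊕-inverseʳ a)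

⊕≡0⇒≡neg : ∀ {a b} → a ⊕ b ≡ 0G → a ≡ neg b
⊕≡0⇒≡neg {a} {b} eq = begin
  a                  ≡⟨ sym (⊕-identityʳ a) ⟩
  a ⊕ 0G             ≡⟨ cong (a ⊕_) (sym (⊕-inverseʳ b)) ⟩
  a ⊕ (b ⊕ neg b)    ≡⟨ sym (⊕-assoc a b (neg b)) ⟩
  (a ⊕ b) ⊕ neg b    ≡⟨ cong (_⊕ neg b) eq ⟩
  0G ⊕ neg b         ≡⟨ ⊕-identityˡ (neg b) ⟩
  neg b              ∎
  where open ≡-Reasoning

telescope : ∀ a b c → (a ⊕ neg b) ⊕ (b ⊕ neg c) ≡ a ⊕ neg c
telescope a b c = begin
  (a ⊕ neg b) ⊕ (b ⊕ neg c)  ≡⟨ ⊕-assoc a (neg b) (b ⊕ neg c) ⟩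
  a ⊕ (neg b ⊕ (b ⊕ neg c))  ≡⟨ cong (a ⊕_) (sym (⊕-assoc (neg b) b (neg c))) ⟩
  a ⊕ ((neg b ⊕ b) ⊕ neg c)  ≡⟨ cong (λ z → a ⊕ (z ⊕ neg c)) (⊕-inverseˡ b) ⟩
  a ⊕ (0G ⊕ neg c)           ≡⟨ cong (a ⊕_) (⊕-identityˡ (neg c)) ⟩
  a ⊕ neg c                  ∎
  where open ≡-Reasoning

-- Indicator factors, signs and finite sums in `Γ`.

on : Bool → Γ → Γ
on true  a = a
on false a = 0G

signed : Bool → Γ → Γ
signed true  a = a
signed false a = neg a

on-⊕ : ∀ b x y → on b (x ⊕ y) ≡ on b x ⊕ on b y
on-⊕ true  x y = refl
on-⊕ false x y = refl

on-neg : ∀ b x → on b (neg x) ≡ neg (on b x)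
on-neg true  x = refl
on-neg false x = refl

≟-refl : ∀ {k} (i : Fin k) → does (i ≟ᶠ i) ≡ true
≟-refl i = dec-true (i ≟ᶠ i) refl

≟-off : ∀ {k} (i j : Fin k) → i ≢ j → does (i ≟ᶠ j) ≡ false
≟-off i j = dec-false (i ≟ᶠ j)

-- Opaque (like ∂ below), since otherwise η for pairs makes unification unfold sums into their components.
opaque
  ∑ : ∀ {k} → (Fin k → Γ) → Γ
  ∑ = sum

  ∑-cong : ∀ {k} {s t : Fin k → Γ} → (∀ i → s i ≡ t i) → ∑ s ≡ ∑ t
  ∑-cong = sum-cong-≗

  ∑-⊕ : ∀ {k} (s t : Fin k → Γ) → ∑ (λ i → s i ⊕ t i) ≡ ∑ s ⊕ ∑ t
  ∑-⊕ = ∑-distrib-+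

  ∑-swap : ∀ {k l} (t : Fin k → Fin l → Γ) → ∑ (λ i → ∑ (t i)) ≡ ∑ (λ j → ∑ λ i → t i j)
  ∑-swap = ∑-comm

  ∑-zero : ∀ {k} {t : Fin k → Γ} → (∀ i → t i ≡ 0G) → ∑ t ≡ 0G
  ∑-zero {k} eq = trans (sum-cong-≗ eq) (sum-replicate-zero k)

  ∑-single : ∀ {k} (t : Fin k → Γ) i → (∀ j → i ≢ j → t j ≡ 0G) → ∑ t ≡ t i
  ∑-single t zero    z = trans (cong (t zero ⊕_) (∑-zero λ j → z (suc j) λ ())) (⊕-identityʳ (t zero))
  ∑-single t (suc i) z = trans
    (cong₂ _⊕_ (z zero λ ()) (∑-single (t ∘ suc) i λ j i≢j → z (suc j) λ { refl → i≢j refl }))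
    (⊕-identityˡ (t (suc i)))

  ∑-hom : ∀ {k} (θ : Γ → Γ) → θ 0G ≡ 0G → (∀ a b → θ (a ⊕ b) ≡ θ a ⊕ θ b) →
          (t : Fin k → Γ) → ∑ (θ ∘ t) ≡ θ (∑ t)
  ∑-hom {ℕ.zero}  θ θ0 θ⊕ t = sym θ0
  ∑-hom {ℕ.suc k} θ θ0 θ⊕ t =
    trans (cong (θ (t zero) ⊕_) (∑-hom θ θ0 θ⊕ (t ∘ suc))) (sym (θ⊕ (t zero) (∑ (t ∘ suc))))

∑-on : ∀ {k} (i : Fin k) (t : Fin k → Γ) → ∑ (λ j → on (does (i ≟ᶠ j)) (t j)) ≡ t i
∑-on i t = trans
  (∑-single _ i λ j i≢j → cong (λ b → on b (t j)) (≟-off i j i≢j))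
  (cong (λ b → on b (t i)) (≟-refl i))

∑-neg : ∀ {k} (t : Fin k → Γ) → ∑ (λ i → neg (t i)) ≡ neg (∑ t)
∑-neg = ∑-hom neg refl neg-⊕

opaque
  -- In Z3 the condition on `c₁` leaves two values for `a`. The equation turns these into two
  -- different values of `b`, of which the condition on `c₂` forbids only one.
  choose-nonzero : ∀ s₁ s₂ t c₁ c₂ → ∃₂ λ a b →
    proj₂ (c₁ ⊕ a) ≢ 0F × proj₂ (c₂ ⊕ b) ≢ 0F × t ⊕ (signed s₁ a ⊕ signed s₂ b) ≡ 0G
  choose-nonzero s₁ s₂ (t , t′) (c₁ , c₁′) (c₂ , c₂′) with go s₁ s₂ t′ c₁′ c₂′
    where
    sg : Bool → Fin 3 → Fin 3
    sg s x = proj₂ (signed s (0F , x))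
    Goal : Bool → Bool → Set
    Goal s₁ s₂ = ∀ t c₁ c₂ → ∃₂ λ a b →
      addMod c₁ a ≢ 0F × addMod c₂ b ≢ 0F × addMod t (addMod (sg s₁ a) (sg s₂ b)) ≡ 0F
    goal? : ∀ s₁ s₂ → Dec (Goal s₁ s₂)
    goal? s₁ s₂ = all? λ t → all? λ c₁ → all? λ c₂ → any? λ a → any? λ b →
      ¬? (addMod c₁ a ≟ᶠ 0F) ×-dec ¬? (addMod c₂ b ≟ᶠ 0F)
        ×-dec (addMod t (addMod (sg s₁ a) (sg s₂ b)) ≟ᶠ 0F)
    go : ∀ s₁ s₂ → Goal s₁ s₂
    go true  true  = from-yes (goal? true true)
    go true  false = from-yes (goal? true false)
    go false true  = from-yes (goal? false true)
    go false false = from-yes (goal? false false)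
  -- No condition binds the Z2-parts beyond the equation, so the second element takes all of `t`;
  -- signs do not affect Z2.
  ... | a , b , p , q , r = (0F , a) , (t , b) , p , q , eq s₁ s₂ r
    where
    double : addMod t (addMod 0F t) ≡ 0F
    double = from-yes (all? λ t → addMod {1} t (addMod 0F t) ≟ᶠ 0F) t
    eq : ∀ s₁ s₂ → addMod t′ (addMod (proj₂ (signed s₁ (0F , a))) (proj₂ (signed s₂ (0F , b)))) ≡ 0F →
         (t , t′) ⊕ (signed s₁ (0F , a) ⊕ signed s₂ (t , b)) ≡ 0G
    eq true  true  r = cong₂ _,_ double r
    eq true  false r = cong₂ _,_ double r
    eq false true  r = cong₂ _,_ double r
    eq false false r = cong₂ _,_ double r

-- The boundary operator on edge assignments.

module Boundary (G : Graph) where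
  open ≡-Reasoning

  V E : Set
  V = Fin (n G)
  E = Fin (m G)

  _⊞_ : (E → Γ) → (E → Γ) → E → Γ
  (φ ⊞ ψ) e = φ e ⊕ ψ e

  χ : E → Γ → E → Γ
  χ e a e′ = on (does (e ≟ᶠ e′)) a

  χ-at : ∀ e a → χ e a e ≡ a
  χ-at e a = cong (λ b → on b a) (≟-refl e)

  χ-off : ∀ e e′ a → e ≢ e′ → χ e a e′ ≡ 0G
  χ-off e e′ a e≢e′ = cong (λ b → on b a) (≟-off e e′ e≢e′)

  opaque
    -- Outflow minus inflow, so that flows are the kernel of an additive map; a loop contributes
    -- nothing.
    ∂ : (E → Γ) → V → Γ
    ∂ φ v = ∑ λ e → on (does (tail G e ≟ᶠ v)) (φ e) ⊕ neg (on (does (head G e ≟ᶠ v)) (φ e))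

    ∂-sum : ∀ φ v → ∂ φ v ≡
            ∑ λ e → on (does (tail G e ≟ᶠ v)) (φ e) ⊕ neg (on (does (head G e ≟ᶠ v)) (φ e))
    ∂-sum φ v = refl

    ∂-⊞ : ∀ φ ψ v → ∂ (φ ⊞ ψ) v ≡ ∂ φ v ⊕ ∂ ψ v
    ∂-⊞ φ ψ v = trans (∑-cong λ e → split (does (tail G e ≟ᶠ v)) (does (head G e ≟ᶠ v)) (φ e) (ψ e))
                      (∑-⊕ _ _)
      where
      split : ∀ b c x y → on b (x ⊕ y) ⊕ neg (on c (x ⊕ y)) ≡ (on b x ⊕ neg (on c x)) ⊕ (on b y ⊕ neg (on c y))
      split b c x y = begin
        on b (x ⊕ y) ⊕ neg (on c (x ⊕ y))
          ≡⟨ cong₂ _⊕_ (on-⊕ b x y) (trans (cong neg (on-⊕ c x y)) (neg-⊕ (on c x) (on c y))) ⟩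
        (on b x ⊕ on b y) ⊕ (neg (on c x) ⊕ neg (on c y))
          ≡⟨ interchange (on b x) (on b y) (neg (on c x)) (neg (on c y)) ⟩
        (on b x ⊕ neg (on c x)) ⊕ (on b y ⊕ neg (on c y)) ∎

    ∂-cong : ∀ {φ ψ} → (∀ e → φ e ≡ ψ e) → ∀ v → ∂ φ v ≡ ∂ ψ v
    ∂-cong eq v = ∑-cong λ e →
      cong (λ x → on (does (tail G e ≟ᶠ v)) x ⊕ neg (on (does (head G e ≟ᶠ v)) x)) (eq e)

    ∂-zero : ∀ {φ} → (∀ e → φ e ≡ 0G) → ∀ v → ∂ φ v ≡ 0G
    ∂-zero eq v = ∑-zero λ e → trans
      (cong (λ x → on (does (tail G e ≟ᶠ v)) x ⊕ neg (on (does (head G e ≟ᶠ v)) x)) (eq e))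
      (both (does (tail G e ≟ᶠ v)) (does (head G e ≟ᶠ v)))
      where
      both : ∀ b c → on b 0G ⊕ neg (on c 0G) ≡ 0G
      both true  true  = refl
      both true  false = refl
      both false true  = refl
      both false false = refl

    -- Applied to the two coordinate projections and to multiplication by 0, 1 and -1, which
    -- therefore preserve flows.
    ∂-hom : ∀ (θ : Γ → Γ) → θ 0G ≡ 0G → (∀ a b → θ (a ⊕ b) ≡ θ a ⊕ θ b) →
            ∀ φ v → ∂ (θ ∘ φ) v ≡ θ (∂ φ v)
    ∂-hom θ θ0 θ⊕ φ v = trans
      (∑-cong λ e → commute (does (tail G e ≟ᶠ v)) (does (head G e ≟ᶠ v)) (φ e))
      (∑-hom θ θ0 θ⊕ _)
      where
      θ-on : ∀ b x → on b (θ x) ≡ θ (on b x)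
      θ-on true  x = refl
      θ-on false x = sym θ0
      θ-neg : ∀ x → neg (θ x) ≡ θ (neg x)
      θ-neg x = sym (⊕≡0⇒≡neg (trans (sym (θ⊕ (neg x) x)) (trans (cong θ (⊕-inverseˡ x)) θ0)))
      commute : ∀ b c x → on b (θ x) ⊕ neg (on c (θ x)) ≡ θ (on b x ⊕ neg (on c x))
      commute b c x = begin
        on b (θ x) ⊕ neg (on c (θ x)) ≡⟨ cong₂ (λ y z → y ⊕ neg z) (θ-on b x) (θ-on c x) ⟩
        θ (on b x) ⊕ neg (θ (on c x)) ≡⟨ cong (θ (on b x) ⊕_) (θ-neg (on c x)) ⟩
        θ (on b x) ⊕ θ (neg (on c x)) ≡⟨ sym (θ⊕ _ _) ⟩
        θ (on b x ⊕ neg (on c x))     ∎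

    ∂-χ : ∀ e a v → ∂ (χ e a) v ≡ on (does (tail G e ≟ᶠ v)) a ⊕ neg (on (does (head G e ≟ᶠ v)) a)
    ∂-χ e a v = trans
      (∑-cong λ e′ → pull (does (e ≟ᶠ e′)) (does (tail G e′ ≟ᶠ v)) (does (head G e′ ≟ᶠ v)))
      (∑-on e λ e′ → on (does (tail G e′ ≟ᶠ v)) a ⊕ neg (on (does (head G e′ ≟ᶠ v)) a))
      where
      pull : ∀ d b c → on b (on d a) ⊕ neg (on c (on d a)) ≡ on d (on b a ⊕ neg (on c a))
      pull true  b     c     = refl
      pull false true  true  = refl
      pull false true  false = refl
      pull false false true  = refl
      pull false false false = refl

    -- Each edge is counted positively at its tail and negatively at its head. Hence balance at all
    -- vertices but one forces balance at the last.
    ∂-total : ∀ φ → ∑ (∂ φ) ≡ 0G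
    ∂-total φ = trans (∑-swap _) (∑-zero λ e → begin
      ∑ (λ v → on (does (tail G e ≟ᶠ v)) (φ e) ⊕ neg (on (does (head G e ≟ᶠ v)) (φ e)))
        ≡⟨ ∑-⊕ _ _ ⟩
      ∑ (λ v → on (does (tail G e ≟ᶠ v)) (φ e)) ⊕ ∑ (λ v → neg (on (does (head G e ≟ᶠ v)) (φ e)))
        ≡⟨ cong₂ _⊕_ (∑-on (tail G e) λ _ → φ e) (trans (∑-neg _) (cong neg (∑-on (head G e) λ _ → φ e))) ⟩
      φ e ⊕ neg (φ e)
        ≡⟨ ⊕-inverseʳ (φ e) ⟩
      0G ∎)

  -- The net flow out of `X`: edges with both ends in `X` cancel, so only the edges crossing its cut
  -- count.
  net : Subset (n G) → (E → Γ) → Γ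
  net X φ = ∑ λ v → on (lookup X v) (∂ φ v)

  net-⊞ : ∀ X φ ψ → net X (φ ⊞ ψ) ≡ net X φ ⊕ net X ψ
  net-⊞ X φ ψ = trans
    (∑-cong λ v → trans (cong (on (lookup X v)) (∂-⊞ φ ψ v)) (on-⊕ (lookup X v) (∂ φ v) (∂ ψ v)))
    (∑-⊕ _ _)

  net-χ : ∀ X e a → net X (χ e a) ≡ on (lookup X (tail G e)) a ⊕ neg (on (lookup X (head G e)) a)
  net-χ X e a = begin
    ∑ (λ v → on (lookup X v) (∂ (χ e a) v))
      ≡⟨ ∑-cong (λ v → trans (cong (on (lookup X v)) (∂-χ e a v))
                             (push (lookup X v) (does (tail G e ≟ᶠ v)) (does (head G e ≟ᶠ v)))) ⟩
    ∑ (λ v → on (does (tail G e ≟ᶠ v)) (on (lookup X v) a) ⊕ neg (on (does (head G e ≟ᶠ v)) (on (lookup X v) a)))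
      ≡⟨ ∑-⊕ _ _ ⟩
    ∑ (λ v → on (does (tail G e ≟ᶠ v)) (on (lookup X v) a))
      ⊕ ∑ (λ v → neg (on (does (head G e ≟ᶠ v)) (on (lookup X v) a)))
      ≡⟨ cong₂ _⊕_ (∑-on (tail G e) λ v → on (lookup X v) a)
                   (trans (∑-neg _) (cong neg (∑-on (head G e) λ v → on (lookup X v) a))) ⟩
    on (lookup X (tail G e)) a ⊕ neg (on (lookup X (head G e)) a) ∎
    where
    push : ∀ x b c → on x (on b a ⊕ neg (on c a)) ≡ on b (on x a) ⊕ neg (on c (on x a))
    push true  b     c     = refl
    push false true  true  = refl
    push false true  false = refl
    push false false true  = refl
    push false false false = refl

  restrict-inside : ∀ (X : Subset (n G)) (β : V → Γ) v → (v ∉ X → β v ≡ 0G) → on (lookup X v) (β v) ≡ β v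
  restrict-inside X β v zero-off with lookup X v in eq
  ... | true  = refl
  ... | false = sym (zero-off λ v∈X → contradiction (trans (sym eq) ([]=⇒lookup v∈X)) λ ())

  restrict-outside : ∀ (X : Subset (n G)) (β : V → Γ) v → (v ∈ X → β v ≡ 0G) → on (lookup X v) (β v) ≡ 0G
  restrict-outside X β v zero-on with lookup X v in eq
  ... | true  = zero-on (lookup⇒[]= v X eq)
  ... | false = refl

-- Walks and trails, and assignments supported on them.

module Walks (G : Graph) where
  open Boundary G
  open ≡-Reasoning

  -- The constructor records the direction of traversal, which `forward` turns into a sign; a loop
  -- can be traversed in both directions.
  Joins : E → V → V → Set
  Joins e u v = (tail G e ≡ u × head G e ≡ v) ⊎ (tail G e ≡ v × head G e ≡ u)

  Joins-sym : ∀ {e u v} → Joins e u v → Joins e v u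
  Joins-sym = Sum.swap

  Joins-ends : ∀ {e u v x} → Joins e u v → tail G e ≡ x ⊎ head G e ≡ x → x ≡ u ⊎ x ≡ v
  Joins-ends (inj₁ (refl , refl)) (inj₁ refl) = inj₁ refl
  Joins-ends (inj₁ (refl , refl)) (inj₂ refl) = inj₂ refl
  Joins-ends (inj₂ (refl , refl)) (inj₁ refl) = inj₂ refl
  Joins-ends (inj₂ (refl , refl)) (inj₂ refl) = inj₁ refl

  Joins-end₁ : ∀ {e u v} → Joins e u v → tail G e ≡ u ⊎ head G e ≡ u
  Joins-end₁ (inj₁ (p , q)) = inj₁ p
  Joins-end₁ (inj₂ (p , q)) = inj₂ q

  forward : ∀ {e u v} → Joins e u v → Bool
  forward (inj₁ _) = true
  forward (inj₂ _) = false

  data Walk : V → V → Set where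
    []   : ∀ {v} → Walk v v
    step : ∀ {u v w} e → Joins e u v → Walk v w → Walk u w

  edges : ∀ {u v} → Walk u v → List E
  edges []           = []
  edges (step e _ W) = e ∷ edges W

  vertices : ∀ {u v} → Walk u v → List V
  vertices {u} []           = u ∷ []
  vertices {u} (step _ _ W) = u ∷ vertices W

  Trail : ∀ {u v} → Walk u v → Set
  Trail W = Unique (edges W)

  _++ʷ_ : ∀ {u v w} → Walk u v → Walk v w → Walk u w
  []         ++ʷ W′ = W′
  step e j W ++ʷ W′ = step e j (W ++ʷ W′)

  reverseʷ : ∀ {u v} → Walk u v → Walk v u
  reverseʷ []           = []
  reverseʷ (step e j W) = reverseʷ W ++ʷ step e (Joins-sym j) []

  edges-++ : ∀ {u v w} (W : Walk u v) (W′ : Walk v w) → edges (W ++ʷ W′) ≡ edges W ++ edges W′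
  edges-++ []           W′ = refl
  edges-++ (step e _ W) W′ = cong (e ∷_) (edges-++ W W′)

  source∈ : ∀ {u v} (W : Walk u v) → u ∈ˡ vertices W
  source∈ []           = here refl
  source∈ (step _ _ _) = here refl

  target∈ : ∀ {u v} (W : Walk u v) → v ∈ˡ vertices W
  target∈ []           = here refl
  target∈ (step _ _ W) = there (target∈ W)

  ∈-vertices-++ˡ : ∀ {u v w x} (W : Walk u v) (W′ : Walk v w) → x ∈ˡ vertices W → x ∈ˡ vertices (W ++ʷ W′)
  ∈-vertices-++ˡ []           W′ (here refl) = source∈ W′
  ∈-vertices-++ˡ (step _ _ W) W′ (here refl) = here refl
  ∈-vertices-++ˡ (step _ _ W) W′ (there x∈)  = there (∈-vertices-++ˡ W W′ x∈)

  ∈-vertices-++⁻ : ∀ {u v w x} (W : Walk u v) (W′ : Walk v w) →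
                   x ∈ˡ vertices (W ++ʷ W′) → x ∈ˡ vertices W ⊎ x ∈ˡ vertices W′
  ∈-vertices-++⁻ []           W′ x∈          = inj₂ x∈
  ∈-vertices-++⁻ (step _ _ W) W′ (here refl) = inj₁ (here refl)
  ∈-vertices-++⁻ (step _ _ W) W′ (there x∈)  = Sum.map₁ there (∈-vertices-++⁻ W W′ x∈)

  ∈-vertices-reverse⁻ : ∀ {u v x} (W : Walk u v) → x ∈ˡ vertices (reverseʷ W) → x ∈ˡ vertices W
  ∈-vertices-reverse⁻ []           x∈ = x∈
  ∈-vertices-reverse⁻ (step e j W) x∈ with ∈-vertices-++⁻ (reverseʷ W) _ x∈
  ... | inj₁ x∈W               = there (∈-vertices-reverse⁻ W x∈W)
  ... | inj₂ (here refl)         = there (source∈ W)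
  ... | inj₂ (there (here refl)) = here refl

  ∈-vertices-++ʳ : ∀ {u v w x} (W : Walk u v) (W′ : Walk v w) → x ∈ˡ vertices W′ → x ∈ˡ vertices (W ++ʷ W′)
  ∈-vertices-++ʳ []           W′ x∈ = x∈
  ∈-vertices-++ʳ (step _ _ W) W′ x∈ = there (∈-vertices-++ʳ W W′ x∈)

  ∈-vertices-reverse⁺ : ∀ {u v x} (W : Walk u v) → x ∈ˡ vertices W → x ∈ˡ vertices (reverseʷ W)
  ∈-vertices-reverse⁺ []           x∈          = x∈
  ∈-vertices-reverse⁺ (step e j W) (here refl) = target∈ (reverseʷ W ++ʷ _)
  ∈-vertices-reverse⁺ (step e j W) (there x∈)  = ∈-vertices-++ˡ (reverseʷ W) _ (∈-vertices-reverse⁺ W x∈)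

  edge-ends∈ : ∀ {u v e x} (W : Walk u v) → e ∈ˡ edges W → tail G e ≡ x ⊎ head G e ≡ x → x ∈ˡ vertices W
  edge-ends∈ (step e j W) (here refl) end with Joins-ends j end
  ... | inj₁ refl = here refl
  ... | inj₂ refl = there (source∈ W)
  edge-ends∈ (step e j W) (there e∈) end = there (edge-ends∈ W e∈ end)

  Trail-++ : ∀ {u v w} (W : Walk u v) (W′ : Walk v w) → Trail W → Trail W′ →
             (∀ {e} → e ∈ˡ edges W → e ∉ˡ edges W′) → Trail (W ++ʷ W′)
  Trail-++ W W′ t t′ disjoint =
    subst Unique (sym (edges-++ W W′)) (Uniqueₚ.++⁺ t t′ λ (e∈ , e∈′) → disjoint e∈ e∈′)

  ∈-edges-++⁻ : ∀ {u v w e} (W : Walk u v) (W′ : Walk v w) →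
                e ∈ˡ edges (W ++ʷ W′) → e ∈ˡ edges W ⊎ e ∈ˡ edges W′
  ∈-edges-++⁻ W W′ e∈ = ∈-++⁻ (edges W) (subst (_ ∈ˡ_) (edges-++ W W′) e∈)

  ∈-edges-reverse⁻ : ∀ {u v e} (W : Walk u v) → e ∈ˡ edges (reverseʷ W) → e ∈ˡ edges W
  ∈-edges-reverse⁻ (step e j W) e∈ with ∈-edges-++⁻ (reverseʷ W) _ e∈
  ... | inj₁ e∈W         = there (∈-edges-reverse⁻ W e∈W)
  ... | inj₂ (here refl) = here refl

  Trail-step : ∀ {u v w e} {j : Joins e u v} {W : Walk v w} → e ∉ˡ edges W → Trail W → Trail (step e j W)
  Trail-step e∉ t = Allₚ.¬Any⇒All¬ _ e∉ ∷ t

  head∉tail : ∀ {u v w e} {j : Joins e u v} {W : Walk v w} → Trail (step e j W) → e ∉ˡ edges W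
  head∉tail (e∉ ∷ _) = Allₚ.All¬⇒¬Any e∉

  Trail-reverse : ∀ {u v} (W : Walk u v) → Trail W → Trail (reverseʷ W)
  Trail-reverse []           t         = []
  Trail-reverse (step e j W) t@(_ ∷ t′) = Trail-++ (reverseʷ W) _ (Trail-reverse W t′) ([] ∷ [])
    λ { e∈ (here refl) → head∉tail {j = j} {W = W} t (∈-edges-reverse⁻ W e∈) }

  record Suffix {u v} (W : Walk u v) (q : V) : Set where
    field
      walk  : Walk q v
      trail : Trail walk
      sub   : ∀ {e} → e ∈ˡ edges walk → e ∈ˡ edges W
      subᵛ  : ∀ {x} → x ∈ˡ vertices walk → x ∈ˡ vertices W

  suffix : ∀ {u v q} (W : Walk u v) → Trail W → q ∈ˡ vertices W → Suffix W q
  suffix W@[]           t       (here refl) = record { walk = W ; trail = t ; sub = λ p → p ; subᵛ = λ p → p }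
  suffix W@(step _ _ _) t       (here refl) = record { walk = W ; trail = t ; sub = λ p → p ; subᵛ = λ p → p }
  suffix (step _ _ W)   (_ ∷ t) (there q∈)  = record
    { walk = S.walk ; trail = S.trail ; sub = there ∘ S.sub ; subᵛ = there ∘ S.subᵛ }
    where module S = Suffix (suffix W t q∈)

  record Splice {u v p q} (W : Walk u v) (Q : Walk p q) : Set where
    field
      walk   : Walk u v
      trail  : Trail walk
      sub    : ∀ {e} → e ∈ˡ edges walk → e ∈ˡ edges W ⊎ e ∈ˡ edges Q
      subᵛ   : ∀ {x} → x ∈ˡ vertices walk → x ∈ˡ vertices W ⊎ x ∈ˡ vertices Q
      covers : ∀ {x} → x ∈ˡ vertices Q → x ∈ˡ vertices walk

  -- The part of W between p and q is discarded in favour of Q, traversed in the direction in which W meets p and q.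
  splice : ∀ {u v p q} (W : Walk u v) (Q : Walk p q) → Trail W → Trail Q →
           (∀ {e} → e ∈ˡ edges Q → e ∉ˡ edges W) →
           p ∈ˡ vertices W → q ∈ˡ vertices W → Splice W Q
  splice {u} {v} {p} {q} W Q tW tQ disjoint p∈ q∈ = go W tW disjoint p∈ q∈
    where
    replace : ∀ {u} (W : Walk u v) → Trail W → (∀ {e} → e ∈ˡ edges Q → e ∉ˡ edges W) →
              ∀ {r} (Q′ : Walk u r) → Trail Q′ →
              (∀ {e} → e ∈ˡ edges Q′ → e ∈ˡ edges Q) →
              (∀ {x} → x ∈ˡ vertices Q′ → x ∈ˡ vertices Q) →
              (∀ {x} → x ∈ˡ vertices Q → x ∈ˡ vertices Q′) →
              r ∈ˡ vertices W → Splice W Q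
    replace W t disj Q′ tQ′ to toᵛ fromᵛ r∈ = record
      { walk   = Q′ ++ʷ S.walk
      ; trail  = Trail-++ Q′ S.walk tQ′ S.trail λ e∈ e∈′ → disj (to e∈) (S.sub e∈′)
      ; sub    = λ e∈ → Sum.swap (Sum.map to S.sub (∈-edges-++⁻ Q′ S.walk e∈))
      ; subᵛ   = λ x∈ → Sum.swap (Sum.map toᵛ S.subᵛ (∈-vertices-++⁻ Q′ S.walk x∈))
      ; covers = λ x∈ → ∈-vertices-++ˡ Q′ S.walk (fromᵛ x∈)
      }
      where module S = Suffix (suffix W t r∈)

    fromSource : ∀ {u} (W : Walk u v) → Trail W → (∀ {e} → e ∈ˡ edges Q → e ∉ˡ edges W) →
                 u ≡ p → q ∈ˡ vertices W → Splice W Q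
    fromSource W t disj refl q∈ = replace W t disj Q tQ (λ e∈ → e∈) (λ x∈ → x∈) (λ x∈ → x∈) q∈

    fromTarget : ∀ {u} (W : Walk u v) → Trail W → (∀ {e} → e ∈ˡ edges Q → e ∉ˡ edges W) →
                 u ≡ q → p ∈ˡ vertices W → Splice W Q
    fromTarget W t disj refl p∈ = replace W t disj (reverseʷ Q) (Trail-reverse Q tQ)
      (∈-edges-reverse⁻ Q) (∈-vertices-reverse⁻ Q) (∈-vertices-reverse⁺ Q) p∈

    go : ∀ {u} (W : Walk u v) → Trail W → (∀ {e} → e ∈ˡ edges Q → e ∉ˡ edges W) →
         p ∈ˡ vertices W → q ∈ˡ vertices W → Splice W Q
    go W@[]           t disj (here refl) q∈          = fromSource W t disj refl q∈
    go W@(step _ _ _) t disj (here refl) q∈          = fromSource W t disj refl q∈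
    go W@(step _ _ _) t disj (there p∈)  (here refl) = fromTarget W t disj refl (there p∈)
    go W₀@(step e j W) t@(_ ∷ t′) disj (there p∈) (there q∈) = record
      { walk   = step e j S.walk
      ; trail  = Trail-step {j = j} {W = S.walk} (λ e∈ → fresh (S.sub e∈)) S.trail
      ; sub    = λ { (here refl) → inj₁ (here refl) ; (there e∈) → Sum.map₁ there (S.sub e∈) }
      ; subᵛ   = λ { (here refl) → inj₁ (here refl) ; (there x∈) → Sum.map₁ there (S.subᵛ x∈) }
      ; covers = λ x∈ → there (S.covers x∈)
      }
      where
      module S = Splice (go W t′ (λ e∈ → disj e∈ ∘ there) p∈ q∈)
      fresh : ¬ (e ∈ˡ edges W ⊎ e ∈ˡ edges Q)
      fresh (inj₁ e∈) = head∉tail {j = j} {W = W} t e∈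
      fresh (inj₂ e∈) = disj e∈ (here refl)

  along : ∀ {u v} → Walk u v → Γ → E → Γ
  along []           a = λ _ → 0G
  along (step e j W) a = χ e (signed (forward j) a) ⊞ along W a

  ∂-step : ∀ {e u v} (j : Joins e u v) a x →
           ∂ (χ e (signed (forward j) a)) x ≡ on (does (u ≟ᶠ x)) a ⊕ neg (on (does (v ≟ᶠ x)) a)
  ∂-step {e} (inj₁ (refl , refl)) a x = ∂-χ e a x
  ∂-step {e} (inj₂ (refl , refl)) a x = trans (∂-χ e (neg a) x)
    (flip (does (tail G e ≟ᶠ x)) (does (head G e ≟ᶠ x)))
    where
    flip : ∀ b c → on b (neg a) ⊕ neg (on c (neg a)) ≡ on c a ⊕ neg (on b a)
    flip b c = begin
      on b (neg a) ⊕ neg (on c (neg a)) ≡⟨ cong₂ (λ y z → y ⊕ neg z) (on-neg b a) (on-neg c a) ⟩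
      neg (on b a) ⊕ neg (neg (on c a)) ≡⟨ cong (neg (on b a) ⊕_) (neg-involutive (on c a)) ⟩
      neg (on b a) ⊕ on c a             ≡⟨ ⊕-comm (neg (on b a)) (on c a) ⟩
      on c a ⊕ neg (on b a)             ∎

  -- What enters an inner vertex also leaves it, so the sum telescopes to the two ends. On a closed
  -- walk these cancel too, and `along` is a flow.
  ∂-along : ∀ {u v} (W : Walk u v) a x →
            ∂ (along W a) x ≡ on (does (u ≟ᶠ x)) a ⊕ neg (on (does (v ≟ᶠ x)) a)
  ∂-along {u} []           a x = trans (∂-zero (λ _ → refl) x) (sym (⊕-inverseʳ (on (does (u ≟ᶠ x)) a)))
  ∂-along {u} {v} (step {v = w} e j W) a x = begin
    ∂ (χ e (signed (forward j) a) ⊞ along W a) x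
      ≡⟨ ∂-⊞ _ _ x ⟩
    ∂ (χ e (signed (forward j) a)) x ⊕ ∂ (along W a) x
      ≡⟨ cong₂ _⊕_ (∂-step j a x) (∂-along W a x) ⟩
    (on (does (u ≟ᶠ x)) a ⊕ neg (on (does (w ≟ᶠ x)) a)) ⊕ (on (does (w ≟ᶠ x)) a ⊕ neg (on (does (v ≟ᶠ x)) a))
      ≡⟨ telescope (on (does (u ≟ᶠ x)) a) (on (does (w ≟ᶠ x)) a) (on (does (v ≟ᶠ x)) a) ⟩
    on (does (u ≟ᶠ x)) a ⊕ neg (on (does (v ≟ᶠ x)) a) ∎

  along-off : ∀ {u v e} (W : Walk u v) a → e ∉ˡ edges W → along W a e ≡ 0G
  along-off []            a e∉ = refl
  along-off {e = e} (step e′ j W) a e∉ = cong₂ _⊕_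
    (χ-off e′ e (signed (forward j) a) λ { refl → e∉ (here refl) }) (along-off W a (e∉ ∘ there))

  -- A trail uses `e` only once, so no second contribution is added to the first.
  along-on : ∀ {u v e} (W : Walk u v) a → Trail W → e ∈ˡ edges W → ∃ λ s → along W a e ≡ signed s a
  along-on (step e j W) a t (here refl) = forward j , (begin
    χ e (signed (forward j) a) e ⊕ along W a e
      ≡⟨ cong₂ _⊕_ (χ-at e _) (along-off W a (head∉tail {j = j} {W = W} t)) ⟩
    signed (forward j) a ⊕ 0G
      ≡⟨ ⊕-identityʳ _ ⟩
    signed (forward j) a ∎)
  along-on {e = e} (step e′ j W) a t@(_ ∷ t′) (there e∈) with along-on W a t′ e∈
  ... | s , eq = s , (begin
    χ e′ (signed (forward j) a) e ⊕ along W a e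
      ≡⟨ cong₂ _⊕_ (χ-off e′ e _ λ { refl → head∉tail {j = j} {W = W} t e∈ }) eq ⟩
    0G ⊕ signed s a
      ≡⟨ ⊕-identityˡ _ ⟩
    signed s a ∎)

  record Absorption {u v} (W : Walk u v) (β : V → Γ) : Set where
    field
      flow     : E → Γ
      support  : ∀ {e} → e ∉ˡ edges W → flow e ≡ 0G
      inside   : ∀ {x} → x ∈ˡ vertices W → x ≢ v → ∂ flow x ≡ β x
      outside  : ∀ {x} → x ∉ˡ vertices W → ∂ flow x ≡ 0G

  -- The demand of each vertex is met on the edge by which the walk leaves it for the last time, at
  -- the expense of the next vertex. The accumulated imbalance ends up at `v`.
  absorb : ∀ {u v} (W : Walk u v) (β : V → Γ) → Absorption W β
  absorb [] β = record
    { flow    = λ _ → 0G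
    ; support = λ _ → refl
    ; inside  = λ { (here refl) x≢v → contradiction refl x≢v }
    ; outside = λ {x} _ → ∂-zero (λ _ → refl) x
    }
  absorb {u} {v} (step {v = w} e j W) β with member? _≟ᶠ_ u (vertices W)
  -- The walk returns to `u`, whose demand is met at a later visit; `e` keeps the value 0.
  ... | yes u∈ = record
    { flow    = A.flow
    ; support = λ e∉ → A.support (e∉ ∘ there)
    ; inside  = λ { (here refl) → A.inside u∈ ; (there x∈) → A.inside x∈ }
    ; outside = λ x∉ → A.outside (x∉ ∘ there)
    }
    where module A = Absorption (absorb W β)
  ... | no u∉ = record
    { flow    = χ e c ⊞ A.flow
    ; support = λ {e′} e∉ → cong₂ _⊕_ (χ-off e e′ c λ { refl → e∉ (here refl) }) (A.support (e∉ ∘ there))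
    ; inside  = λ { (here refl) _ → at-u ; (there x∈) → at-rest x∈ }
    ; outside = λ {x} x∉ → trans (∂-flow x) (cong₂ _⊕_
        (cong₂ (λ b d → on b (β u) ⊕ neg (on d (β u)))
          (≟-off u x λ { refl → x∉ (here refl) }) (≟-off w x λ { refl → x∉ (there (source∈ W)) }))
        (A.outside (x∉ ∘ there)))
    }
    where
    c : Γ
    c = signed (forward j) (β u)
    -- Sending `β u` over `e` lowers the boundary at `w` by that amount, which the rest of the walk
    -- has to make up.
    β′ : V → Γ
    β′ x = β x ⊕ on (does (w ≟ᶠ x)) (β u)
    module A = Absorption (absorb W β′)
    ∂-flow : ∀ x → ∂ (χ e c ⊞ A.flow) x ≡
             (on (does (u ≟ᶠ x)) (β u) ⊕ neg (on (does (w ≟ᶠ x)) (β u))) ⊕ ∂ A.flow x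
    ∂-flow x = trans (∂-⊞ (χ e c) A.flow x) (cong (_⊕ ∂ A.flow x) (∂-step j (β u) x))
    at-u : ∂ (χ e c ⊞ A.flow) u ≡ β u
    at-u = begin
      ∂ (χ e c ⊞ A.flow) u
        ≡⟨ ∂-flow u ⟩
      (on (does (u ≟ᶠ u)) (β u) ⊕ neg (on (does (w ≟ᶠ u)) (β u))) ⊕ ∂ A.flow u
        ≡⟨ cong₂ (λ b d → (on b (β u) ⊕ neg (on d (β u))) ⊕ ∂ A.flow u)
             (≟-refl u) (≟-off w u λ { refl → u∉ (source∈ W) }) ⟩
      (β u ⊕ 0G) ⊕ ∂ A.flow u
        ≡⟨ cong₂ _⊕_ (⊕-identityʳ (β u)) (A.outside u∉) ⟩
      β u ⊕ 0G
        ≡⟨ ⊕-identityʳ (β u) ⟩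
      β u ∎
    at-rest : ∀ {x} → x ∈ˡ vertices W → x ≢ v → ∂ (χ e c ⊞ A.flow) x ≡ β x
    at-rest {x} x∈ x≢v = begin
      ∂ (χ e c ⊞ A.flow) x
        ≡⟨ ∂-flow x ⟩
      (on (does (u ≟ᶠ x)) (β u) ⊕ neg δ) ⊕ ∂ A.flow x
        ≡⟨ cong₂ (λ b z → (on b (β u) ⊕ neg δ) ⊕ z) (≟-off u x λ { refl → u∉ x∈ }) (A.inside x∈ x≢v) ⟩
      (0G ⊕ neg δ) ⊕ (β x ⊕ δ)
        ≡⟨ cong₂ _⊕_ (⊕-identityˡ (neg δ)) (⊕-comm (β x) δ) ⟩
      neg δ ⊕ (δ ⊕ β x)
        ≡⟨ ⊕-assoc (neg δ) δ (β x) ⟨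
      (neg δ ⊕ δ) ⊕ β x
        ≡⟨ cong (_⊕ β x) (⊕-inverseˡ δ) ⟩
      0G ⊕ β x
        ≡⟨ ⊕-identityˡ (β x) ⟩
      β x ∎
      where
      δ : Γ
      δ = on (does (w ≟ᶠ x)) (β u)

-- Closed trails through two vertices, minimal leaves and ears.

module Ears (G : Graph) where
  open Boundary G
  open Walks G

  ⊂-∪-⁅⁆ : ∀ {k} {A : Subset k} {v} → v ∉ A → A ⊂ A ∪ ⁅ v ⁆
  ⊂-∪-⁅⁆ {A = A} {v} v∉A = p⊆p∪q ⁅ v ⁆ , v , x∈p∪q⁺ (inj₂ (x∈⁅x⁆ v)) , v∉A

  ∈-∪-⁅⁆⁻ : ∀ {k} {A : Subset k} {v x} → x ∈ A ∪ ⁅ v ⁆ → x ∈ A ⊎ x ≡ v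
  ∈-∪-⁅⁆⁻ {A = A} {v} x∈ = Sum.map₂ (x∈⁅y⁆⇒x≡y v) (x∈p∪q⁻ A ⁅ v ⁆ x∈)

  Internal : Subset (n G) → Subset (n G) → E → Set
  Internal L A e = ∃₂ λ u v → Joins e u v × u ∈ A × v ∈ L × v ∉ A

  -- The cut form of the statement that the subgraph induced on `L` stays connected when any one
  -- edge is deleted.
  TwoEdgeConnected : Subset (n G) → Set
  TwoEdgeConnected L = ∀ A → Nonempty A → A ⊆ L → (∃ λ b → b ∈ L × b ∉ A) →
                       ∀ e → ∃ λ e′ → e′ ≢ e × Internal L A e′

  record ClosedTrail (L : Subset (n G)) (x z : V) : Set where
    field
      walk   : Walk x x
      trail  : Trail walk
      within : ∀ {v} → v ∈ˡ vertices walk → v ∈ L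
      visits : z ∈ˡ vertices walk

  module _ {L : Subset (n G)} (connected : TwoEdgeConnected L) where

    -- A set A of vertices joined to q by trails is grown off the given closed trail; the exits of A other
    -- than e eventually lead back to the closed trail, so that with e they form the new ear.
    addEar : ∀ {x e p q} → ClosedTrail L x p → Joins e p q → q ∈ L → ClosedTrail L x q
    addEar {x} {e} {p} {q} C j q∈L with member? _≟ᶠ_ q (vertices (ClosedTrail.walk C))
    ... | yes q∈C = record { ClosedTrail C hiding (visits) ; visits = q∈C }
    ... | no  q∉C = grow ⁅ q ⁆ (⊃-wellFounded _) (x∈⁅x⁆ q)
          (λ v∈ → subst (_∈ L) (sym (x∈⁅y⁆⇒x≡y q v∈)) q∈L)
          (λ v∈ v∈C → q∉C (subst (_∈ˡ vertices walk) (x∈⁅y⁆⇒x≡y q v∈) v∈C))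
          (λ v∈ → subst (Reached ⁅ q ⁆) (sym (x∈⁅y⁆⇒x≡y q v∈)) ([] , [] , λ { (here refl) → x∈⁅x⁆ q }))
      where
      open ClosedTrail C
      Reached : Subset (n G) → V → Set
      Reached A v = Σ (Walk q v) λ Q → Trail Q × (∀ {w} → w ∈ˡ vertices Q → w ∈ A)

      -- The last component confines every edge except `e′` to `A`. As `A` avoids the closed trail,
      -- it makes the ear edge-disjoint from that trail.
      extend : ∀ {A u v e′} → Reached A u → Joins e′ u v → v ∉ A →
               Σ (Walk q v) λ Q → Trail Q
                 × (∀ {w} → w ∈ˡ vertices Q → w ∈ A ⊎ w ≡ v)
                 × (∀ {d} → d ∈ˡ edges Q → d ≡ e′ ⊎ ∀ w → tail G d ≡ w ⊎ head G d ≡ w → w ∈ A)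
      extend {A} {u} {v} {e′} (Q , t , ⊆A) j′ v∉A =
        Q ++ʷ step e′ j′ []
        , Trail-++ Q _ t ([] ∷ []) (λ { d∈ (here refl) → v∉A (inA d∈ _ (Joins-end₁ (Joins-sym j′))) })
        , (λ w∈ → Sum.[ inj₁ ∘ ⊆A , (λ { (here refl) → inj₁ (⊆A (target∈ Q)) ; (there (here refl)) → inj₂ refl }) ]
                    (∈-vertices-++⁻ Q _ w∈))
        , (λ d∈ → Sum.[ (λ d∈Q → inj₂ (inA d∈Q)) , (λ { (here refl) → inj₁ refl }) ] (∈-edges-++⁻ Q _ d∈))
        where
        inA : ∀ {d} → d ∈ˡ edges Q → ∀ w → tail G d ≡ w ⊎ head G d ≡ w → w ∈ A
        inA d∈ _ end = ⊆A (edge-ends∈ Q d∈ end)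

      grow : ∀ A → Acc _⊃_ A → q ∈ A → (∀ {v} → v ∈ A → v ∈ L) →
             (∀ {v} → v ∈ A → v ∉ˡ vertices walk) → (∀ {v} → v ∈ A → Reached A v) →
             ClosedTrail L x q
      grow A (acc rec) q∈A A⊆L apart reach
        with connected A (q , q∈A) A⊆L (p , within visits , λ p∈A → apart p∈A visits) e
      ... | e′ , e′≢e , u , v , j′ , u∈A , v∈L , v∉A with extend (reach u∈A) j′ v∉A | member? _≟ᶠ_ v (vertices walk)
      ...   | Q , t , Q⊆ , Qe | no v∉C =
        grow (A ∪ ⁅ v ⁆) (rec (⊂-∪-⁅⁆ v∉A)) (p⊆p∪q _ q∈A)
          (λ w∈ → Sum.[ A⊆L , (λ { refl → v∈L }) ] (∈-∪-⁅⁆⁻ w∈))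
          (λ w∈ → Sum.[ apart , (λ { refl → v∉C }) ] (∈-∪-⁅⁆⁻ w∈))
          (λ w∈ → Sum.[ earlier ∘ reach , (λ { refl → latest }) ] (∈-∪-⁅⁆⁻ w∈))
        where
        earlier : ∀ {w} → Reached A w → Reached (A ∪ ⁅ v ⁆) w
        earlier (R , r , R⊆A) = R , r , λ x∈ → p⊆p∪q ⁅ v ⁆ (R⊆A x∈)
        latest : Reached (A ∪ ⁅ v ⁆) v
        latest = Q , t , λ x∈ → x∈p∪q⁺ (Sum.map₂ (λ { refl → x∈⁅x⁆ v }) (Q⊆ x∈))
      ...   | Q , t , Q⊆ , Qe | yes v∈C = record
        { walk   = S.walk
        ; trail  = S.trail
        ; within = λ w∈ → Sum.[ within , withinQ ] (S.subᵛ w∈)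
        ; visits = S.covers (there (source∈ Q))
        }
        where
        withinQ : ∀ {w} → w ∈ˡ vertices (step e j Q) → w ∈ L
        withinQ (here refl) = within visits
        withinQ (there w∈)  = Sum.[ A⊆L , (λ { refl → v∈L }) ] (Q⊆ w∈)
        e∉Q : e ∉ˡ edges Q
        e∉Q e∈ = Sum.[ (λ { refl → e′≢e refl }) , (λ inA → apart (inA _ (Joins-end₁ j)) visits) ] (Qe e∈)
        fresh : ∀ {d} → d ∈ˡ edges (step e j Q) → d ∉ˡ edges walk
        fresh (here refl) d∈C = q∉C (edge-ends∈ walk d∈C (Joins-end₁ (Joins-sym j)))
        fresh (there d∈)  d∈C with Qe d∈
        ... | inj₁ refl = apart u∈A (edge-ends∈ walk d∈C (Joins-end₁ j′))
        ... | inj₂ inA  = apart (inA _ (inj₁ refl)) (edge-ends∈ walk d∈C (inj₁ refl))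
        module S = Splice (splice walk (step e j Q) trail (Trail-step {j = j} {W = Q} e∉Q t) fresh visits v∈C)

    -- The set `R` of vertices that share a closed trail with `x` grows by one vertex along each
    -- edge leaving it, by `addEar`, until it contains `y`.
    closedTrail : E → ∀ {x y} → x ∈ L → y ∈ L → ClosedTrail L x y
    closedTrail e {x} {y} x∈L y∈L = grow ⁅ x ⁆ (⊃-wellFounded _) (x∈⁅x⁆ x)
        (λ v∈ → subst (_∈ L) (sym (x∈⁅y⁆⇒x≡y x v∈)) x∈L)
        (λ v∈ → subst (ClosedTrail L x) (sym (x∈⁅y⁆⇒x≡y x v∈))
          (record { walk = [] ; trail = [] ; within = λ { (here refl) → x∈L } ; visits = here refl }))
      where
      grow : ∀ R → Acc _⊃_ R → x ∈ R → (∀ {v} → v ∈ R → v ∈ L) →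
             (∀ {v} → v ∈ R → ClosedTrail L x v) → ClosedTrail L x y
      grow R (acc rec) x∈R R⊆L reach with y ∈? R
      ... | yes y∈R = reach y∈R
      -- Plain connectedness suffices here: any edge leaving `R` will do, and `e` only fills the
      -- place of the deleted edge.
      ... | no  y∉R with connected R (x , x∈R) R⊆L (y , y∈L , y∉R) e
      ...   | _ , _ , u , v , j , u∈R , v∈L , v∉R =
        grow (R ∪ ⁅ v ⁆) (rec (⊂-∪-⁅⁆ v∉R)) (p⊆p∪q _ x∈R)
          (λ w∈ → Sum.[ R⊆L , (λ { refl → v∈L }) ] (∈-∪-⁅⁆⁻ w∈))
          (λ w∈ → Sum.[ reach , (λ { refl → addEar (reach u∈R) j v∈L }) ] (∈-∪-⁅⁆⁻ w∈))

  Joins? : ∀ e u v → Dec (Joins e u v)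
  Joins? e u v = (tail G e ≟ᶠ u ×-dec head G e ≟ᶠ v) ⊎-dec (tail G e ≟ᶠ v ×-dec head G e ≟ᶠ u)

  module _ (U : Subset (n G)) where

    Exits : Subset (n G) → E → Set
    Exits A e = ∃₂ λ u v → Joins e u v × u ∈ A × v ∉ A × v ∉ U

    TwoExits : Subset (n G) → Set
    TwoExits A = ∃₂ λ e e′ → e ≢ e′ × Exits A e × Exits A e′

    -- At most one edge runs from `L` to the rest of the complement of `U`. The minimal such sets
    -- are the isolated vertices and leaves of the bridge forest of `G` minus `U`.
    Leaf : Subset (n G) → Set
    Leaf L = Nonempty L × L ⊆ ∁ U × ¬ TwoExits L

    Exits? : ∀ A e → Dec (Exits A e)
    Exits? A e = any? λ u → any? λ v → Joins? e u v ×-dec u ∈? A ×-dec ¬? (v ∈? A) ×-dec ¬? (v ∈? U)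

    TwoExits? : ∀ A → Dec (TwoExits A)
    TwoExits? A = any? λ e → any? λ e′ → ¬? (e ≟ᶠ e′) ×-dec Exits? A e ×-dec Exits? A e′

    Leaf? : ∀ L → Dec (Leaf L)
    Leaf? L = nonempty? L ×-dec L ⊆? ∁ U ×-dec ¬? (TwoExits? L)

    MinimalLeaf : Subset (n G) → Set
    MinimalLeaf L = Leaf L × (∀ A → A ⊂ L → ¬ Leaf A)

    minimalLeaf : ∀ L → Leaf L → ∃ MinimalLeaf
    minimalLeaf L = go L (⊂-wellFounded L)
      where
      go : ∀ L → Acc _⊂_ L → Leaf L → ∃ MinimalLeaf
      go L (acc rec) leaf with anySubset? (λ A → A ⊂? L ×-dec Leaf? A)
      ... | yes (A , A⊂L , leafA) = go A (rec A⊂L) leafA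
      ... | no none               = L , leaf , λ A A⊂L leafA → none (A , A⊂L , leafA)

    -- The only edge that may leave L towards the rest of ∁ U leaves at most one of A and L ∖ A.  By minimality
    -- both have two exits, and for the other set these run between A and L ∖ A.
    minimalLeaf-connected : ∀ {L} → MinimalLeaf L → TwoEdgeConnected L
    minimalLeaf-connected {L} ((_ , L⊆∁U , ¬two) , minimal) A A≠∅ A⊆L (b , b∈L , b∉A) e
      with two A A≠∅ (A⊆L , b , b∈L , b∉A)
         | two B (b , x∈p∩q⁺ (b∈L , x∉p⇒x∈∁p b∉A))
                 (p∩q⊆p L (∁ A) , proj₁ A≠∅ , A⊆L (proj₂ A≠∅) , ∉B (proj₂ A≠∅))
      where
      B : Subset (n G)
      B = L ∩ ∁ A
      ∉B : ∀ {v} → v ∈ A → v ∉ B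
      ∉B v∈A v∈B = x∈∁p⇒x∉p (proj₂ (x∈p∩q⁻ L (∁ A) v∈B)) v∈A
      two : ∀ A → Nonempty A → A ⊂ L → TwoExits A
      two A A≠∅ A⊂L = decidable-stable (TwoExits? A) λ ¬twoA →
        minimal A A⊂L (A≠∅ , L⊆∁U ∘ proj₁ A⊂L , ¬twoA)
    ... | e₁ , e₂ , e₁≢e₂ , out₁ , out₂ | f₁ , f₂ , f₁≢f₂ , outf₁ , outf₂ =
      conclude (classifyA out₁) (classifyA out₂)
      where
      B : Subset (n G)
      B = L ∩ ∁ A
      Leaves : Subset (n G) → E → Set
      Leaves A e = ∃₂ λ u v → Joins e u v × u ∈ A × v ∉ L × v ∉ U
      classifyA : ∀ {e} → Exits A e → Internal L A e ⊎ Leaves A e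
      classifyA (u , v , j , u∈A , v∉A , v∉U) with v ∈? L
      ... | yes v∈L = inj₁ (u , v , j , u∈A , v∈L , v∉A)
      ... | no  v∉L = inj₂ (u , v , j , u∈A , v∉L , v∉U)
      classifyB : ∀ {e} → Exits B e → Internal L A e ⊎ Leaves B e
      classifyB (u , v , j , u∈B , v∉B , v∉U) with v ∈? L
      ... | no  v∉L = inj₂ (u , v , j , u∈B , v∉L , v∉U)
      ... | yes v∈L = let u∈L , u∈∁A = x∈p∩q⁻ L (∁ A) u∈B in
        inj₁ (v , u , Joins-sym j , x∉∁p⇒x∈p (λ v∈∁A → v∉B (x∈p∩q⁺ (v∈L , v∈∁A))) , u∈L , x∈∁p⇒x∉p u∈∁A)
      exclusive : ∀ {c d} → Leaves A c → ¬ Leaves B d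
      exclusive {c} {d} (u , v , j , u∈A , v∉L , v∉U) (u′ , v′ , j′ , u′∈B , v′∉L , v′∉U) with c ≟ᶠ d
      ... | no c≢d = ¬two (c , d , c≢d , (u , v , j , A⊆L u∈A , v∉L , v∉U)
                                       , (u′ , v′ , j′ , proj₁ (x∈p∩q⁻ L (∁ A) u′∈B) , v′∉L , v′∉U))
      ... | yes refl with x∈p∩q⁻ L (∁ A) u′∈B | Joins-ends j (Joins-end₁ j′)
      ...   | _ , u∈∁A | inj₁ refl = x∈∁p⇒x∉p u∈∁A u∈A
      ...   | v∈L , _  | inj₂ refl = v∉L v∈L
      pick : ∀ {e₁ e₂} → e₁ ≢ e₂ → Internal L A e₁ → Internal L A e₂ → ∃ λ e′ → e′ ≢ e × Internal L A e′
      pick {e₁} {e₂} e₁≢e₂ i₁ i₂ with e₁ ≟ᶠ e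
      ... | no e₁≢e  = e₁ , e₁≢e , i₁
      ... | yes refl = e₂ , e₁≢e₂ ∘ sym , i₂
      stays : ∀ {c d} → Leaves A c → Exits B d → Internal L A d
      stays l out = Sum.[ (λ i → i) , (λ l′ → contradiction l′ (exclusive l)) ] (classifyB out)
      conclude : Internal L A e₁ ⊎ Leaves A e₁ → Internal L A e₂ ⊎ Leaves A e₂ →
                 ∃ λ e′ → e′ ≢ e × Internal L A e′
      conclude (inj₁ i₁) (inj₁ i₂) = pick e₁≢e₂ i₁ i₂
      conclude (inj₂ l)  _         = pick f₁≢f₂ (stays l outf₁) (stays l outf₂)
      conclude _         (inj₂ l)  = pick f₁≢f₂ (stays l outf₁) (stays l outf₂)

    -- Only the two edges have to differ: `base` and `end` may coincide, as may the feet, and the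
    -- walk may be trivial.
    record Ear : Set where
      field
        base end foot₁ foot₂ : V
        walk   : Walk base base
        trail  : Trail walk
        avoids : ∀ {v} → v ∈ˡ vertices walk → v ∉ U
        visits : end ∈ˡ vertices walk
        e₁ e₂  : E
        e₁≢e₂  : e₁ ≢ e₂
        joins₁ : Joins e₁ base foot₁
        joins₂ : Joins e₂ end foot₂
        foot₁∈ : foot₁ ∈ U
        foot₂∈ : foot₂ ∈ U

    -- At least three edges leave a minimal leaf `L`, and at most one of them avoids `U`. So two
    -- land in `U`, and a closed trail in `L` passes through their ends.
    ear : EdgeConnected 3 G → Nonempty U → Nonempty (∁ U) → Ear
    ear (_ , cut≥3) (u₀ , u₀∈U) ∁U≠∅ with minimalLeaf (∁ U)
      -- The complement of `U` has no exits at all, so it is a leaf from which the descent can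
      -- start.
      (∁U≠∅ , (λ v∈ → v∈) , λ { (_ , _ , _ , (_ , _ , _ , _ , v∉∁U , v∉U) , _) → v∉U (x∉∁p⇒x∈p v∉∁U) })
    ... | L , minL@(((v₀ , v₀∈L) , L⊆∁U , ¬two) , _) =
      fromCut (cut≥3 L (v₀ , v₀∈L) (u₀ , λ u₀∈L → x∈∁p⇒x∉p (L⊆∁U u₀∈L) u₀∈U))
      where
      Lands : E → Set
      Lands e = ∃₂ λ u v → Joins e u v × u ∈ L × v ∈ U
      classify : ∀ {e} → Crosses G L e → Lands e ⊎ Exits L e
      classify {e} (inj₁ (t∈ , h∉)) with head G e ∈? U
      ... | yes h∈U = inj₁ (_ , _ , inj₁ (refl , refl) , t∈ , h∈U)
      ... | no  h∉U = inj₂ (_ , _ , inj₁ (refl , refl) , t∈ , h∉ , h∉U)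
      classify {e} (inj₂ (t∉ , h∈)) with tail G e ∈? U
      ... | yes t∈U = inj₁ (_ , _ , inj₂ (refl , refl) , h∈ , t∈U)
      ... | no  t∉U = inj₂ (_ , _ , inj₂ (refl , refl) , h∈ , t∉ , t∉U)
      build : ∀ {e₁ e₂} → e₁ ≢ e₂ → Lands e₁ → Lands e₂ → Ear
      build {e₁} {e₂} e₁≢e₂ (x , a , j₁ , x∈L , a∈U) (y , b , j₂ , y∈L , b∈U) = record
        { base = x ; end = y ; foot₁ = a ; foot₂ = b
        ; walk = C.walk ; trail = C.trail ; avoids = λ v∈ → x∈∁p⇒x∉p (L⊆∁U (C.within v∈)) ; visits = C.visits
        ; e₁ = e₁ ; e₂ = e₂ ; e₁≢e₂ = e₁≢e₂ ; joins₁ = j₁ ; joins₂ = j₂ ; foot₁∈ = a∈U ; foot₂∈ = b∈U }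
        where module C = ClosedTrail (closedTrail (minimalLeaf-connected minL) e₁ x∈L y∈L)
      choose : ∀ {a b c} → a ≢ b → a ≢ c → b ≢ c →
               Lands a ⊎ Exits L a → Lands b ⊎ Exits L b → Lands c ⊎ Exits L c → Ear
      choose a≢b a≢c b≢c (inj₁ a) (inj₁ b) _        = build a≢b a b
      choose a≢b a≢c b≢c (inj₁ a) (inj₂ _) (inj₁ c) = build a≢c a c
      choose a≢b a≢c b≢c (inj₂ _) (inj₁ b) (inj₁ c) = build b≢c b c
      choose a≢b a≢c b≢c (inj₂ a) (inj₂ b) _        = contradiction (_ , _ , a≢b , a , b) ¬two
      choose a≢b a≢c b≢c (inj₂ a) (inj₁ _) (inj₂ c) = contradiction (_ , _ , a≢c , a , c) ¬two
      choose a≢b a≢c b≢c (inj₁ _) (inj₂ b) (inj₂ c) = contradiction (_ , _ , b≢c , b , c) ¬two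
      fromCut : 3 ≤ cutSize G L → Ear
      fromCut 3≤ with filter (Crosses? G L) (allFin (m G)) | Allₚ.all-filter (Crosses? G L) (allFin (m G))
                    | Uniqueₚ.filter⁺ (Crosses? G L) (Uniqueₚ.allFin⁺ (m G)) | 3≤
      ... | _ ∷ _ ∷ _ ∷ _ | a ∷ b ∷ c ∷ _ | (a≢b ∷ a≢c ∷ _) ∷ (b≢c ∷ _) ∷ _ | _ =
        choose a≢b a≢c b≢c (classify a) (classify b) (classify c)
      ... | []         | _ | _ | ()
      ... | _ ∷ []     | _ | _ | s≤s ()
      ... | _ ∷ _ ∷ [] | _ | _ | s≤s (s≤s ())

-- Vertex sets of walks, and the construction of the two flows.

lookup-∉ : ∀ {k} {X : Subset k} {v} → v ∉ X → lookup X v ≡ false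
lookup-∉ {X = X} {v} v∉X with lookup X v in eq
... | true  = contradiction (lookup⇒[]= v X eq) v∉X
... | false = refl

fromList : ∀ {k} → List (Fin k) → Subset k
fromList []       = ⊥
fromList (x ∷ xs) = ⁅ x ⁆ ∪ fromList xs

fromList⁺ : ∀ {k} {xs : List (Fin k)} {x} → x ∈ˡ xs → x ∈ fromList xs
fromList⁺ (here refl) = x∈p∪q⁺ (inj₁ (x∈⁅x⁆ _))
fromList⁺ (there x∈)  = x∈p∪q⁺ (inj₂ (fromList⁺ x∈))

fromList⁻ : ∀ {k} (xs : List (Fin k)) {x} → x ∈ fromList xs → x ∈ˡ xs
fromList⁻ []       x∈ = contradiction x∈ ∉⊥
fromList⁻ (y ∷ xs) x∈ with x∈p∪q⁻ ⁅ y ⁆ (fromList xs) x∈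
... | inj₁ x∈y  = here (x∈⁅y⁆⇒x≡y y x∈y)
... | inj₂ x∈xs = there (fromList⁻ xs x∈xs)

-- As a value of `F`, its Z2-part marks the edges of the even subgraph and its Z3-part orients them.
one : Γ
one = 1F , 1F

module Seymour (G : Graph) where
  open Boundary G
  open Walks G
  open Ears G
  open ≡-Reasoning

  Touches : Subset (n G) → E → Set
  Touches U e = tail G e ∈ U ⊎ head G e ∈ U

  -- U stands for a single contracted vertex, at which f need not be balanced.
  record Partial (U : Subset (n G)) : Set where
    field
      f F     : E → Γ
      F-flow  : ∀ v → ∂ F v ≡ 0G
      F-value : ∀ e → F e ≡ 0G ⊎ ∃ λ s → F e ≡ signed s one
      -- Keeps `F` zero on the edges of the next closed trail, which lies in the contracted set, so
      -- that it becomes exactly ±`one` there.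
      F-off   : ∀ {e} → Touches U e → F e ≡ 0G
      f-value : ∀ e → F e ≡ 0G → proj₂ (f e) ≢ 0F
      f-flow  : ∀ v → v ∉ U → ∂ f v ≡ 0G

  ∂-χ-away : ∀ {e v} a → ¬ (tail G e ≡ v ⊎ head G e ≡ v) → ∂ (χ e a) v ≡ 0G
  ∂-χ-away {e} {v} a away = trans (∂-χ e a v)
    (cong₂ (λ b c → on b a ⊕ neg (on c a))
      (≟-off (tail G e) v (away ∘ inj₁)) (≟-off (head G e) v (away ∘ inj₂)))

  net-crossing : ∀ {X e u v} (j : Joins e u v) → u ∈ X → v ∉ X → ∀ a → net X (χ e a) ≡ signed (forward j) a
  net-crossing {X} {e} (inj₁ (refl , refl)) u∈X v∉X a = begin
    net X (χ e a)
      ≡⟨ net-χ X e a ⟩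
    on (lookup X (tail G e)) a ⊕ neg (on (lookup X (head G e)) a)
      ≡⟨ cong₂ (λ b c → on b a ⊕ neg (on c a)) ([]=⇒lookup u∈X) (lookup-∉ v∉X) ⟩
    a ⊕ 0G
      ≡⟨ ⊕-identityʳ a ⟩
    a ∎
  net-crossing {X} {e} (inj₂ (refl , refl)) u∈X v∉X a = begin
    net X (χ e a)
      ≡⟨ net-χ X e a ⟩
    on (lookup X (tail G e)) a ⊕ neg (on (lookup X (head G e)) a)
      ≡⟨ cong₂ (λ b c → on b a ⊕ neg (on c a)) (lookup-∉ v∉X) ([]=⇒lookup u∈X) ⟩
    0G ⊕ neg a
      ≡⟨ ⊕-identityˡ (neg a) ⟩
    neg a ∎

  signed-one≢0 : ∀ s → signed s one ≢ 0G
  signed-one≢0 true  ()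
  signed-one≢0 false ()

  -- The trail is split off from the contracted set. Its edges get nonzero `F`, so `f` is
  -- unconstrained on them and can be corrected vertex by vertex. Such corrections cannot change the
  -- net flow out of the trail's vertex set, which `e₁` and `e₂` first bring to zero.
  extend : ∀ {U} (C : Ear U) → Partial (U ∪ fromList (vertices (Ear.walk C))) → Partial U
  extend {U} C P = record
    { f = f ; F = F ; F-flow = F-flow ; F-value = F-value ; F-off = F-off ; f-value = f-value ; f-flow = f-flow }
    where
    open Ear C
    module P = Partial P
    X : Subset (n G)
    X = fromList (vertices walk)

    F : E → Γ
    F = P.F ⊞ along walk one

    F-flow : ∀ v → ∂ F v ≡ 0G
    F-flow v = trans (∂-⊞ P.F (along walk one) v)
      (cong₂ _⊕_ (P.F-flow v) (trans (∂-along walk one v) (⊕-inverseʳ (on (does (base ≟ᶠ v)) one))))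

    F-on : ∀ {e} → e ∈ˡ edges walk → ∃ λ s → F e ≡ signed s one
    F-on {e} e∈ with along-on walk one trail e∈
    ... | s , eq = s , (begin
      P.F e ⊕ along walk one e
        ≡⟨ cong₂ _⊕_ (P.F-off (inj₁ (x∈p∪q⁺ (inj₂ (fromList⁺ (edge-ends∈ walk e∈ (inj₁ refl))))))) eq ⟩
      0G ⊕ signed s one
        ≡⟨ ⊕-identityˡ (signed s one) ⟩
      signed s one ∎)

    F-same : ∀ {e} → e ∉ˡ edges walk → F e ≡ P.F e
    F-same {e} e∉ = trans (cong (P.F e ⊕_) (along-off walk one e∉)) (⊕-identityʳ (P.F e))

    F-value : ∀ e → F e ≡ 0G ⊎ ∃ λ s → F e ≡ signed s one
    F-value e with member? _≟ᶠ_ e (edges walk)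
    ... | yes e∈ = inj₂ (F-on e∈)
    ... | no  e∉ = subst (λ x → x ≡ 0G ⊎ ∃ λ s → x ≡ signed s one) (sym (F-same e∉)) (P.F-value e)

    touches∉ : ∀ {e} → Touches U e → e ∉ˡ edges walk
    touches∉ (inj₁ t∈) e∈ = avoids (edge-ends∈ walk e∈ (inj₁ refl)) t∈
    touches∉ (inj₂ h∈) e∈ = avoids (edge-ends∈ walk e∈ (inj₂ refl)) h∈

    F-off : ∀ {e} → Touches U e → F e ≡ 0G
    F-off t = trans (F-same (touches∉ t)) (P.F-off (Sum.map (p⊆p∪q X) (p⊆p∪q X) t))

    chosen : ∃₂ λ a b → proj₂ (P.f e₁ ⊕ a) ≢ 0F × proj₂ (P.f e₂ ⊕ b) ≢ 0F
               × net X P.f ⊕ (signed (forward joins₁) a ⊕ signed (forward joins₂) b) ≡ 0G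
    chosen = choose-nonzero (forward joins₁) (forward joins₂) (net X P.f) (P.f e₁) (P.f e₂)
    a b : Γ
    a = proj₁ chosen
    b = proj₁ (proj₂ chosen)

    g : E → Γ
    g = (P.f ⊞ χ e₁ a) ⊞ χ e₂ b

    -- The prescribed boundary cancels that of `g` at every vertex of the trail except `base`.
    module A = Absorption (absorb walk (λ v → neg (∂ g v)))

    f : E → Γ
    f = g ⊞ A.flow

    foot∉X : ∀ {v} → v ∈ U → v ∉ X
    foot∉X v∈U v∈X = avoids (fromList⁻ (vertices walk) v∈X) v∈U

    net-g : net X g ≡ 0G
    net-g = begin
      net X g
        ≡⟨ net-⊞ X (P.f ⊞ χ e₁ a) (χ e₂ b) ⟩
      net X (P.f ⊞ χ e₁ a) ⊕ net X (χ e₂ b)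
        ≡⟨ cong (_⊕ net X (χ e₂ b)) (net-⊞ X P.f (χ e₁ a)) ⟩
      (net X P.f ⊕ net X (χ e₁ a)) ⊕ net X (χ e₂ b)
        ≡⟨ ⊕-assoc (net X P.f) (net X (χ e₁ a)) (net X (χ e₂ b)) ⟩
      net X P.f ⊕ (net X (χ e₁ a) ⊕ net X (χ e₂ b))
        ≡⟨ cong (net X P.f ⊕_) (cong₂ _⊕_
             (net-crossing joins₁ (fromList⁺ (source∈ walk)) (foot∉X foot₁∈) a)
             (net-crossing joins₂ (fromList⁺ visits) (foot∉X foot₂∈) b)) ⟩
      net X P.f ⊕ (signed (forward joins₁) a ⊕ signed (forward joins₂) b)
        ≡⟨ proj₂ (proj₂ (proj₂ (proj₂ chosen))) ⟩
      0G ∎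

    -- `A.flow` has no boundary outside `X`, so its net flow out of `X` is its whole boundary sum.
    net-A : net X A.flow ≡ 0G
    net-A = trans (∑-cong λ v → restrict-inside X (∂ A.flow) v λ v∉ → A.outside (v∉ ∘ fromList⁺)) (∂-total A.flow)

    ∂f : ∀ v → ∂ f v ≡ ∂ g v ⊕ ∂ A.flow v
    ∂f = ∂-⊞ g A.flow

    f-inside : ∀ {v} → v ∈ X → v ≢ base → ∂ f v ≡ 0G
    f-inside {v} v∈ v≢ = trans (∂f v)
      (trans (cong (∂ g v ⊕_) (A.inside (fromList⁻ (vertices walk) v∈) v≢)) (⊕-inverseʳ (∂ g v)))

    -- All other vertices of `X` are balanced, so the boundary at `base` equals the net flow out of
    -- `X`.
    f-base : ∂ f base ≡ 0G
    f-base = begin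
      ∂ f base
        ≡⟨ cong (λ s → on s (∂ f base)) ([]=⇒lookup (fromList⁺ (source∈ walk))) ⟨
      on (lookup X base) (∂ f base)
        ≡⟨ ∑-single (λ v → on (lookup X v) (∂ f v)) base
             (λ v base≢v → restrict-outside X (∂ f) v λ v∈ → f-inside v∈ (base≢v ∘ sym)) ⟨
      net X f
        ≡⟨ net-⊞ X g A.flow ⟩
      net X g ⊕ net X A.flow
        ≡⟨ cong₂ _⊕_ net-g net-A ⟩
      0G ∎

    f-outside : ∀ {v} → v ∉ U → v ∉ X → ∂ f v ≡ 0G
    f-outside {v} v∉U v∉X = begin
      ∂ f v
        ≡⟨ ∂f v ⟩
      ∂ g v ⊕ ∂ A.flow v
        ≡⟨ cong₂ _⊕_ (trans (∂-⊞ (P.f ⊞ χ e₁ a) (χ e₂ b) v) (cong (_⊕ ∂ (χ e₂ b) v) (∂-⊞ P.f (χ e₁ a) v)))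
                     (A.outside (v∉X ∘ fromList⁺)) ⟩
      ((∂ P.f v ⊕ ∂ (χ e₁ a) v) ⊕ ∂ (χ e₂ b) v) ⊕ 0G
        ≡⟨ cong (_⊕ 0G) (cong₂ _⊕_ (cong₂ _⊕_
             (P.f-flow v (Sum.[ v∉U , v∉X ] ∘ x∈p∪q⁻ U X))
             (∂-χ-away a (away joins₁ (source∈ walk) foot₁∈)))
             (∂-χ-away b (away joins₂ visits foot₂∈))) ⟩
      0G ∎
      where
      away : ∀ {e x y} → Joins e x y → x ∈ˡ vertices walk → y ∈ U → ¬ (tail G e ≡ v ⊎ head G e ≡ v)
      away j x∈ y∈ end with Joins-ends j end
      ... | inj₁ refl = v∉X (fromList⁺ x∈)
      ... | inj₂ refl = v∉U y∈

    f-flow : ∀ v → v ∉ U → ∂ f v ≡ 0G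
    f-flow v v∉U = cases (v ∈? X) (v ≟ᶠ base)
      where
      cases : Dec (v ∈ X) → Dec (v ≡ base) → ∂ f v ≡ 0G
      cases _        (yes v≡) = subst (λ x → ∂ f x ≡ 0G) (sym v≡) f-base
      cases (yes v∈) (no v≢)  = f-inside v∈ v≢
      cases (no v∉)  (no _)   = f-outside v∉U v∉

    -- Since `e₁` and `e₂` are distinct, no edge receives both adjustments.
    g-value : ∀ e → proj₂ (P.f e) ≢ 0F → proj₂ (g e) ≢ 0F
    g-value e f≢0 = cases (e ≟ᶠ e₁) (e ≟ᶠ e₂)
      where
      via : ∀ {x} → g e ≡ x → proj₂ x ≢ 0F → proj₂ (g e) ≢ 0F
      via eq x≢0 g≡0 = x≢0 (trans (sym (cong proj₂ eq)) g≡0)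
      cases : Dec (e ≡ e₁) → Dec (e ≡ e₂) → proj₂ (g e) ≢ 0F
      cases (yes refl) (yes refl) = contradiction refl e₁≢e₂
      cases (yes refl) (no e≢e₂)  = via {P.f e ⊕ a} (begin
        (P.f e ⊕ χ e a e) ⊕ χ e₂ b e ≡⟨ cong₂ _⊕_ (cong (P.f e ⊕_) (χ-at e a)) (χ-off e₂ e b (e≢e₂ ∘ sym)) ⟩
        (P.f e ⊕ a) ⊕ 0G             ≡⟨ ⊕-identityʳ (P.f e ⊕ a) ⟩
        P.f e ⊕ a                    ∎) (proj₁ (proj₂ (proj₂ chosen)))
      cases (no e≢e₁)  (yes refl) = via {P.f e ⊕ b} (begin
        (P.f e ⊕ χ e₁ a e) ⊕ χ e b e ≡⟨ cong₂ _⊕_ (cong (P.f e ⊕_) (χ-off e₁ e a (e≢e₁ ∘ sym))) (χ-at e b) ⟩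
        (P.f e ⊕ 0G) ⊕ b             ≡⟨ cong (_⊕ b) (⊕-identityʳ (P.f e)) ⟩
        P.f e ⊕ b                    ∎) (proj₁ (proj₂ (proj₂ (proj₂ chosen))))
      cases (no e≢e₁)  (no e≢e₂)  = via {P.f e} (begin
        (P.f e ⊕ χ e₁ a e) ⊕ χ e₂ b e
          ≡⟨ cong₂ _⊕_ (cong (P.f e ⊕_) (χ-off e₁ e a (e≢e₁ ∘ sym))) (χ-off e₂ e b (e≢e₂ ∘ sym)) ⟩
        (P.f e ⊕ 0G) ⊕ 0G
          ≡⟨ ⊕-identityʳ (P.f e ⊕ 0G) ⟩
        P.f e ⊕ 0G
          ≡⟨ ⊕-identityʳ (P.f e) ⟩
        P.f e ∎) f≢0

    f-value : ∀ e → F e ≡ 0G → proj₂ (f e) ≢ 0F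
    f-value e Fe≡0 = cases (member? _≟ᶠ_ e (edges walk))
      where
      cases : Dec (e ∈ˡ edges walk) → proj₂ (f e) ≢ 0F
      cases (yes e∈) = let s , eq = F-on e∈ in contradiction (trans (sym eq) Fe≡0) (signed-one≢0 s)
      cases (no  e∉) fe≡0 = g-value e (P.f-value e (trans (sym (F-same e∉)) Fe≡0))
        (trans (sym (cong proj₂ (trans (cong (g e ⊕_) (A.support e∉)) (⊕-identityʳ (g e))))) fe≡0)

  -- Ears are found while `U` grows, and the flows are built on the way back, as `U` shrinks again.
  partial : EdgeConnected 3 G → ∀ U → Acc _⊃_ U → Nonempty U → Partial U
  partial conn U (acc rec) U≠∅ with nonempty? (∁ U)
  -- Once `U` contains every vertex no balance of `f` is demanded, so a constant with nonzero
  -- Z3-part serves.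
  ... | no ∁U=∅ = record
    { f = λ _ → one
    ; F = λ _ → 0G
    ; F-flow = ∂-zero λ _ → refl
    ; F-value = λ _ → inj₁ refl
    ; F-off = λ _ → refl
    ; f-value = λ _ _ ()
    ; f-flow = λ v v∉U → contradiction (v , x∉p⇒x∈∁p v∉U) ∁U=∅
    }
  ... | yes ∁U≠∅ = extend C (partial conn _ (rec larger) (proj₁ U≠∅ , p⊆p∪q _ (proj₂ U≠∅)))
    where
    C : Ear U
    C = ear U conn U≠∅ ∁U≠∅
    larger : U ⊂ U ∪ fromList (vertices (Ear.walk C))
    larger = p⊆p∪q _ , Ear.base C , x∈p∪q⁺ (inj₂ (fromList⁺ (source∈ (Ear.walk C))))
           , Ear.avoids C (source∈ (Ear.walk C))

  record FlowPair : Set where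
    field
      f F     : E → Γ
      F-flow  : ∀ v → ∂ F v ≡ 0G
      F-value : ∀ e → F e ≡ 0G ⊎ ∃ λ s → F e ≡ signed s one
      f-flow  : ∀ v → ∂ f v ≡ 0G
      f-value : ∀ e → F e ≡ 0G → proj₂ (f e) ≢ 0F

  -- Contracting the single vertex `r` changes nothing but the balance of `f` at `r`, which follows
  -- from balance everywhere else.
  flowPair : EdgeConnected 3 G → V → FlowPair
  flowPair conn r = record { P ; f-flow = f-flow }
    where
    module P = Partial (partial conn ⁅ r ⁆ (⊃-wellFounded _) (r , x∈⁅x⁆ r))
    f-flow-off : ∀ v → r ≢ v → ∂ P.f v ≡ 0G
    f-flow-off v r≢v = P.f-flow v λ v∈ → r≢v (sym (x∈⁅y⁆⇒x≡y r v∈))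
    f-flow : ∀ v → ∂ P.f v ≡ 0G
    f-flow v with r ≟ᶠ v
    ... | yes refl = trans (sym (∑-single (∂ P.f) r f-flow-off)) (∂-total P.f)
    ... | no  r≢v  = f-flow-off v r≢v

-- Sums of natural numbers, parities and the sums in the definition of a flow.

indicator : Bool → ℕ
indicator true  = 1
indicator false = 0

sum-mono : ∀ {k} {s t : Fin k → ℕ} → (∀ i → s i ≤ t i) → ℕΣ.sum s ≤ ℕΣ.sum t
sum-mono {ℕ.zero}  le = z≤n
sum-mono {ℕ.suc k} le = +-mono-≤ (le zero) (sum-mono (le ∘ suc))

sum-const : ∀ k c → ℕΣ.sum {k} (λ _ → c) ≡ k * c
sum-const ℕ.zero    c = refl
sum-const (ℕ.suc k) c = cong (c +_) (sum-const k c)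

sum-* : ∀ {k} c (t : Fin k → ℕ) → ℕΣ.sum (λ i → c * t i) ≡ c * ℕΣ.sum t
sum-* {ℕ.zero}  c t = sym (*-zeroʳ c)
sum-* {ℕ.suc k} c t = trans (cong (c * t zero +_) (sum-* c (t ∘ suc))) (sym (*-distribˡ-+ c (t zero) _))

sum-indicator : ∀ {k} (i : Fin k) c → ℕΣ.sum (λ j → indicator (does (i ≟ᶠ j)) * c) ≡ c
sum-indicator {ℕ.suc k} zero    c =
  trans (cong₂ _+_ (+-identityʳ c) (trans (sum-const k 0) (*-zeroʳ k))) (+-identityʳ c)
sum-indicator           (suc i) c = sum-indicator i c

length-filter-allFin : ∀ {k} {P : Fin k → Set} (P? : ∀ i → Dec (P i)) →
                       length (filter P? (allFin k)) ≡ ℕΣ.sum (λ i → indicator (does (P? i)))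
length-filter-allFin {k} P? = go k id
  where
  go : ∀ l (g : Fin l → Fin k) → length (filter P? (tabulate g)) ≡ ℕΣ.sum (λ i → indicator (does (P? (g i))))
  go ℕ.zero    g = refl
  go (ℕ.suc l) g with P? (g zero)
  ... | yes _ = cong ℕ.suc (go l (g ∘ suc))
  ... | no  _ = go l (g ∘ suc)

parity : ℕ → Fin 2
parity ℕ.zero    = 0F
parity (ℕ.suc k) = addMod 1F (parity k)

parity-+ : ∀ k l → parity (k + l) ≡ addMod (parity k) (parity l)
parity-+ ℕ.zero    l = from-yes (all? λ b → b ≟ᶠ addMod {1} 0F b) (parity l)
parity-+ (ℕ.suc k) l = trans (cong (addMod 1F) (parity-+ k l))
  (from-yes (all? λ a → all? λ b → addMod {1} 1F (addMod a b) ≟ᶠ addMod (addMod 1F a) b) (parity k) (parity l))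

opaque
  unfolding ∑

  parity-sum : ∀ {k} (s : Fin k → ℕ) (t : Fin k → Γ) → (∀ i → parity (s i) ≡ proj₁ (t i)) →
               parity (ℕΣ.sum s) ≡ proj₁ (∑ t)
  parity-sum {ℕ.zero}  s t eq = refl
  parity-sum {ℕ.suc k} s t eq = trans (parity-+ (s zero) (ℕΣ.sum (s ∘ suc)))
    (cong₂ addMod (eq zero) (parity-sum (s ∘ suc) (t ∘ suc) (eq ∘ suc)))

  foldr-∑ : ∀ {k} (h : Fin k → Γ → Γ) (t : Fin k → Γ) → (∀ e x → h e x ≡ t e ⊕ x) →
            foldr h 0G (allFin k) ≡ ∑ t
  foldr-∑ {k} h t eq = go k id
    where
    go : ∀ l (g : Fin l → Fin k) → foldr h 0G (tabulate g) ≡ ∑ (t ∘ g)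
    go ℕ.zero    g = refl
    go (ℕ.suc l) g = trans (eq (g zero) _) (cong (t (g zero) ⊕_) (go l (g ∘ suc)))

-- The left-hand side is a call of the local function of sumOver, which can only be named by unification,
-- so its type is solved when sumOver-∑ is checked.
sumOver-step : ∀ {k} (P : Fin k → Set) (P? : ∀ e → Dec (P e)) (φ : Fin k → Γ) e x → _ ≡ on (does (P? e)) (φ e) ⊕ x
sumOver-∑ : ∀ {k} (P : Fin k → Set) (P? : ∀ e → Dec (P e)) (φ : Fin k → Γ) →
            sumOver P P? φ ≡ ∑ (λ e → on (does (P? e)) (φ e))
sumOver-∑ P P? φ = foldr-∑ _ _ (sumOver-step P P? φ)
sumOver-step P P? φ e x with P? e
... | yes _ = refl
... | no  _ = sym (⊕-identityˡ x)

-- Pigeonhole over binary-valued functions.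

largerFibre : ∀ {A : Set} (c : A → Fin 2) (xs : List A) →
              ∃ λ b → length xs ≤ 2 * length (filter (λ x → c x ≟ᶠ b) xs)
largerFibre c xs = larger (≤-total (count 0F) (count 1F))
  where
  count : Fin 2 → ℕ
  count b = length (filter (λ x → c x ≟ᶠ b) xs)
  split : ∀ ys → length ys ≤ length (filter (λ x → c x ≟ᶠ 0F) ys) + length (filter (λ x → c x ≟ᶠ 1F) ys)
  split []       = z≤n
  split (y ∷ ys) with c y
  ... | 0F = s≤s (split ys)
  ... | 1F = ≤-trans (s≤s (split ys)) (≤-reflexive (sym (+-suc _ _)))
  larger : count 0F ≤ count 1F ⊎ count 1F ≤ count 0F → ∃ λ b → length xs ≤ 2 * count b
  larger (inj₁ le) = 1F , ≤-trans (split xs) (≤-trans (+-monoˡ-≤ (count 1F) le)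
    (≤-reflexive (cong (count 1F +_) (sym (+-identityʳ (count 1F))))))
  larger (inj₂ le) = 0F , ≤-trans (split xs) (≤-trans (+-monoʳ-≤ (count 0F) le)
    (≤-reflexive (cong (count 0F +_) (sym (+-identityʳ (count 0F))))))

-- Passing to the larger fibre of each function in turn costs at most a factor 2 per function.
pigeonhole : ∀ {A : Set} (cs : List (A → Fin 2)) (xs : List A) → Unique xs →
             ∃ λ ys → Unique ys × (∀ {c x y} → c ∈ˡ cs → x ∈ˡ ys → y ∈ˡ ys → c x ≡ c y)
               × length xs ≤ 2 ^ length cs * length ys
pigeonhole []       xs u = xs , u , (λ ()) , ≤-reflexive (sym (+-identityʳ (length xs)))
pigeonhole (c ∷ cs) xs u with pigeonhole cs xs u
... | ys , u′ , agree , bound with largerFibre c ys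
...   | b , large = filter c? ys , Uniqueₚ.filter⁺ c? u′ , agree′ , (begin
  length xs                                         ≤⟨ bound ⟩
  2 ^ length cs * length ys                         ≤⟨ *-monoʳ-≤ (2 ^ length cs) large ⟩
  2 ^ length cs * (2 * length (filter c? ys))       ≡⟨ *-assoc (2 ^ length cs) 2 _ ⟨
  2 ^ length cs * 2 * length (filter c? ys)         ≡⟨ cong (_* length (filter c? ys)) (*-comm (2 ^ length cs) 2) ⟩
  2 ^ length (c ∷ cs) * length (filter c? ys)       ∎)
  where
  open ≤-Reasoning
  c? : ∀ x → Dec (c x ≡ b)
  c? x = c x ≟ᶠ b
  agree′ : ∀ {d x y} → d ∈ˡ c ∷ cs → x ∈ˡ filter c? ys → y ∈ˡ filter c? ys → d x ≡ d y
  agree′ (here refl) x∈ y∈ = trans (proj₂ (∈-filter⁻ c? {xs = ys} x∈)) (sym (proj₂ (∈-filter⁻ c? {xs = ys} y∈)))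
  agree′ (there d∈)  x∈ y∈ = agree d∈ (proj₁ (∈-filter⁻ c? x∈)) (proj₁ (∈-filter⁻ c? y∈))

bitVectors : ∀ k → ∃ λ (xs : List (Vec (Fin 2) k)) → Unique xs × length xs ≡ 2 ^ k
bitVectors ℕ.zero    = [] ∷ [] , [] ∷ [] , refl
bitVectors (ℕ.suc k) with bitVectors k
... | xs , u , len = cartesianProductWith _∷_ (allFin 2) xs
  , Uniqueₚ.cartesianProductWith⁺ _∷_ ∷-injective (Uniqueₚ.allFin⁺ 2) u
  , (begin
    length (map (0F ∷_) xs ++ (map (1F ∷_) xs ++ [])) ≡⟨ length-++ (map (0F ∷_) xs) ⟩
    length (map (0F ∷_) xs) + length (map (1F ∷_) xs ++ [])
      ≡⟨ cong₂ _+_ (length-map (0F ∷_) xs) (length-++ (map (1F ∷_) xs)) ⟩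
    length xs + (length (map (1F ∷_) xs) + 0) ≡⟨ cong (λ l → length xs + (l + 0)) (length-map (1F ∷_) xs) ⟩
    2 * length xs                             ≡⟨ cong (2 *_) len ⟩
    2 ^ ℕ.suc k                               ∎)
  where open ≡-Reasoning

-- Degree counting for the even subgraph.

module Degrees (G : Graph) where
  open Boundary G

  -- Loops count twice. Constant weight 1 gives the ordinary degree, and the Z2-part of `F` as
  -- weight gives the degree in the even subgraph.
  degree : (E → ℕ) → V → ℕ
  degree w v = ℕΣ.sum λ e → indicator (does (tail G e ≟ᶠ v)) * w e + indicator (does (head G e ≟ᶠ v)) * w e

  handshake : ∀ w → ℕΣ.sum (degree w) ≡ 2 * ℕΣ.sum w
  handshake w = begin
    ℕΣ.sum (degree w)
      ≡⟨ ℕΣ.∑-comm {n G} {m G} _ ⟩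
    ℕΣ.sum (λ e → ℕΣ.sum λ v → indicator (does (tail G e ≟ᶠ v)) * w e + indicator (does (head G e ≟ᶠ v)) * w e)
      ≡⟨ ℕΣ.sum-cong-≗ (λ e → trans (ℕΣ.∑-distrib-+ {n G} _ _)
           (cong₂ _+_ (sum-indicator (tail G e) (w e))
                      (trans (sum-indicator (head G e) (w e)) (sym (+-identityʳ (w e)))))) ⟩
    ℕΣ.sum (λ e → 2 * w e)
      ≡⟨ sum-* 2 w ⟩
    2 * ℕΣ.sum w ∎
    where open ≡-Reasoning

  degree-mono : ∀ {w w′} → (∀ e → w e ≤ w′ e) → ∀ v → degree w v ≤ degree w′ v
  degree-mono le v = sum-mono λ e → +-mono-≤
    (*-monoʳ-≤ (indicator (does (tail G e ≟ᶠ v))) (le e)) (*-monoʳ-≤ (indicator (does (head G e ≟ᶠ v))) (le e))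

  cutSize≤degree : ∀ v → cutSize G ⁅ v ⁆ ≤ degree (λ _ → 1) v
  cutSize≤degree v = ≤-trans (≤-reflexive (length-filter-allFin (Crosses? G ⁅ v ⁆)))
                             (sum-mono λ e → crossing e (Crosses? G ⁅ v ⁆ e))
    where
    crossing : ∀ e (crosses? : Dec (Crosses G ⁅ v ⁆ e)) → indicator (does crosses?) ≤
                 indicator (does (tail G e ≟ᶠ v)) * 1 + indicator (does (head G e ≟ᶠ v)) * 1
    crossing e (no _) = z≤n
    crossing e (yes (inj₁ (t∈ , _))) rewrite dec-true (tail G e ≟ᶠ v) (x∈⁅y⁆⇒x≡y v t∈) = s≤s z≤n
    crossing e (yes (inj₂ (_ , h∈))) rewrite dec-true (head G e ≟ᶠ v) (x∈⁅y⁆⇒x≡y v h∈) = m≤n+m 1 _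

  degree≥3 : EdgeConnected 3 G → ∀ v → 3 ≤ degree (λ _ → 1) v
  degree≥3 (2≤n , cut≥3) v = ≤-trans (cut≥3 ⁅ v ⁆ (v , x∈⁅x⁆ v) (other 2≤n v)) (cutSize≤degree v)
    where
    other : ∀ {k} → 2 ≤ k → (v : Fin k) → ∃ λ u → u ∉ ⁅ v ⁆
    other (s≤s (s≤s _)) zero    = 1F , λ u∈ → contradiction (x∈⁅y⁆⇒x≡y 0F u∈) λ ()
    other (s≤s (s≤s _)) (suc v) = 0F , λ u∈ → contradiction (x∈⁅y⁆⇒x≡y (suc v) u∈) λ ()

  -- Signs disappear modulo 2, so this degree reduces to the Z2-part of the boundary.
  degree-parity : ∀ F v → ∂ F v ≡ 0G → parity (degree (λ e → toℕ (proj₁ (F e))) v) ≡ 0F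
  degree-parity F v ∂F≡0 = trans (parity-sum _ _ λ e → local (does (tail G e ≟ᶠ v)) (does (head G e ≟ᶠ v)) (F e))
                                 (cong proj₁ (trans (sym (∂-sum F v)) ∂F≡0))
    where
    local : ∀ b c x → parity (indicator b * toℕ (proj₁ x) + indicator c * toℕ (proj₁ x)) ≡
                      proj₁ (on b x ⊕ neg (on c x))
    local true  true  (0F , _) = refl
    local true  true  (1F , _) = refl
    local true  false (0F , _) = refl
    local true  false (1F , _) = refl
    local false true  (0F , _) = refl
    local false true  (1F , _) = refl
    local false false (0F , _) = refl
    local false false (1F , _) = refl

  -- If `d` is at least 4, then 7 is below `2 * d` and `c` is at most `d`. If `d` is 3, evenness
  -- lowers `c` to at most 2, with equality for `c` equal to 2.
  even-degree-bound : ∀ {c d} → 3 ≤ d → c ≤ d → parity c ≡ 0F → 7 + c ≤ 3 * d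
  even-degree-bound {c} {d} 3≤d c≤d even with 4 ≤? d
  ... | yes 4≤d = begin
    7 + c        ≤⟨ +-mono-≤ (≤-trans (n≤1+n 7) (*-monoʳ-≤ 2 4≤d)) c≤d ⟩
    2 * d + d    ≡⟨ +-comm (2 * d) d ⟩
    3 * d        ∎
    where open ≤-Reasoning
  ... | no 4≰d with ≤-antisym 3≤d (≤-pred (≰⇒> 4≰d))
  ...   | refl = cubic c≤d even
    where
    cubic : ∀ {c} → c ≤ 3 → parity c ≡ 0F → 7 + c ≤ 9
    cubic {0} _ _ = m≤m+n 7 2
    cubic {1} _ _ = m≤m+n 8 1
    cubic {2} _ _ = ≤-refl
    cubic {3} _ ()
    cubic {ℕ.suc (ℕ.suc (ℕ.suc (ℕ.suc _)))} (s≤s (s≤s (s≤s ()))) _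

  -- The vertex bound is summed over all vertices, and `handshake` evaluates the degree sums on both
  -- sides.
  even-subgraph-bound : EdgeConnected 3 G → ∀ F → (∀ v → ∂ F v ≡ 0G) →
                        7 * n G + 2 * ℕΣ.sum (λ e → toℕ (proj₁ (F e))) ≤ 6 * m G
  even-subgraph-bound conn F F-flow = begin
    7 * n G + 2 * ℕΣ.sum w
      ≡⟨ cong₂ _+_ (trans (*-comm 7 (n G)) (sym (sum-const (n G) 7))) (sym (handshake w)) ⟩
    ℕΣ.sum {n G} (λ _ → 7) + ℕΣ.sum (degree w)
      ≡⟨ ℕΣ.∑-distrib-+ (λ _ → 7) (degree w) ⟨
    ℕΣ.sum (λ v → 7 + degree w v)
      ≤⟨ sum-mono (λ v → even-degree-bound (degree≥3 conn v) (degree-mono (λ e → bit≤1 (proj₁ (F e))) v)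
                                           (degree-parity F v (F-flow v))) ⟩
    ℕΣ.sum (λ v → 3 * degree (λ _ → 1) v)
      ≡⟨ sum-* 3 (degree (λ _ → 1)) ⟩
    3 * ℕΣ.sum (degree (λ _ → 1))
      ≡⟨ cong (3 *_) (trans (handshake (λ _ → 1)) (cong (2 *_) (trans (sum-const (m G) 1) (*-identityʳ (m G))))) ⟩
    3 * (2 * m G)
      ≡⟨ *-assoc 3 2 (m G) ⟨
    6 * m G ∎
    where
    open ≤-Reasoning
    w : E → ℕ
    w e = toℕ (proj₁ (F e))
    bit≤1 : ∀ (b : Fin 2) → toℕ b ≤ 1
    bit≤1 0F = z≤n
    bit≤1 1F = ≤-refl

-- Projections and multiples, the flow criterion and the final arithmetic.

π₁ π₂ : Γ → Γ
π₁ (x , _) = x , 0F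
π₂ (_ , y) = 0F , y

π₁-⊕ : ∀ a b → π₁ (a ⊕ b) ≡ π₁ a ⊕ π₁ b
π₁-⊕ _ _ = refl

π₂-⊕ : ∀ a b → π₂ (a ⊕ b) ≡ π₂ a ⊕ π₂ b
π₂-⊕ _ _ = refl

-- The index `2F` stands for -1, so that `f ⊞ (scale k ∘ F)` runs through f, f + F and f - F.
scale : Fin 3 → Γ → Γ
scale 0F x = 0G
scale 1F x = x
scale 2F x = neg x

scale-0 : ∀ k → scale k 0G ≡ 0G
scale-0 0F = refl
scale-0 1F = refl
scale-0 2F = refl

scale-⊕ : ∀ k a b → scale k (a ⊕ b) ≡ scale k a ⊕ scale k b
scale-⊕ 0F a b = refl
scale-⊕ 1F a b = refl
scale-⊕ 2F a b = neg-⊕ a b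

flow-criterion : ∀ (G : Graph) (φ : Assignment G) →
                 (∀ v → Boundary.∂ G (lookup φ) v ≡ 0G) → IsFlow G φ
flow-criterion G φ ∂φ≡0 v = begin
  sumOver (λ e → tail G e ≡ v) (λ e → tail G e ≟ᶠ v) (lookup φ)
    ≡⟨ sumOver-∑ _ (λ e → tail G e ≟ᶠ v) (lookup φ) ⟩
  ∑ out
    ≡⟨ ⊕≡0⇒≡neg (trans (cong (∑ out ⊕_) (sym (∑-neg inn)))
                     (trans (sym (∑-⊕ out (λ e → neg (inn e))))
                            (trans (sym (Boundary.∂-sum G (lookup φ) v)) (∂φ≡0 v)))) ⟩
  neg (neg (∑ inn))
    ≡⟨ neg-involutive (∑ inn) ⟩
  ∑ inn
    ≡⟨ sumOver-∑ _ (λ e → head G e ≟ᶠ v) (lookup φ) ⟨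
  sumOver (λ e → head G e ≡ v) (λ e → head G e ≟ᶠ v) (lookup φ) ∎
  where
  open ≡-Reasoning
  out inn : Fin (m G) → Γ
  out e = on (does (tail G e ≟ᶠ v)) (lookup φ e)
  inn e = on (does (head G e ≟ᶠ v)) (lookup φ e)

one-of-three : ∀ (z : Fin 3 → ℕ) c → z 0F + z 1F + z 2F ≤ c → ∃ λ k → 3 * z k ≤ c
one-of-three z c le with 3 * z 0F ≤? c | 3 * z 1F ≤? c | 3 * z 2F ≤? c
... | yes p | _     | _     = 0F , p
... | no _  | yes p | _     = 1F , p
... | no _  | no _  | yes p = 2F , p
... | no p  | no q  | no r  = contradiction (begin-strict
  3 * (z 0F + z 1F + z 2F)          ≤⟨ *-monoʳ-≤ 3 le ⟩
  3 * c                             ≡⟨ triple c ⟩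
  c + c + c                         <⟨ +-mono-< (+-mono-< (≰⇒> p) (≰⇒> q)) (≰⇒> r) ⟩
  3 * z 0F + 3 * z 1F + 3 * z 2F    ≡⟨ distrib (z 0F) (z 1F) (z 2F) ⟩
  3 * (z 0F + z 1F + z 2F)          ∎) (<-irrefl refl)
  where
  open ≤-Reasoning
  triple : ∀ c → 3 * c ≡ c + c + c
  triple = solve-∀
  distrib : ∀ x y z → 3 * x + 3 * y + 3 * z ≡ 3 * (x + y + z)
  distrib = solve-∀

^-distribʳ-* : ∀ k x y → (x * y) ^ k ≡ x ^ k * y ^ k
^-distribʳ-* ℕ.zero    x y = refl
^-distribʳ-* (ℕ.suc k) x y =
  trans (cong (x * y *_) (^-distribʳ-* k x y)) ([m*n]*[o*p]≡[m*o]*[n*p] x y (x ^ k) (y ^ k))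

-- The sixth power of the counting bound is compared with 6(n + z) + n = 7n + 6z ≤ 7n + 2c ≤ 6m.
-- Cancelling the common power of 2 leaves 2^n ≤ L^6.
exponent-bound : ∀ n m z c L → 7 * n + 2 * c ≤ 6 * m → 3 * z ≤ c → 2 ^ m ≤ 2 ^ (n + z) * L → 2 ^ n ≤ L ^ 7
exponent-bound n m z c L edges≥ 3z≤c count = ≤-trans sixth (power L)
  where
  open ≤-Reasoning
  rearrange : ∀ n z → (n + z) * 6 + n ≡ 7 * n + 2 * (3 * z)
  rearrange = solve-∀
  power : ∀ L → L ^ 6 ≤ L ^ 7
  power ℕ.zero      = z≤n
  power L@(ℕ.suc _) = m≤n*m (L ^ 6) L
  sixth : 2 ^ n ≤ L ^ 6
  sixth = *-cancelˡ-≤ (2 ^ ((n + z) * 6)) {{m^n≢0 2 ((n + z) * 6)}} (begin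
    2 ^ ((n + z) * 6) * 2 ^ n     ≡⟨ ^-distribˡ-+-* 2 ((n + z) * 6) n ⟨
    2 ^ ((n + z) * 6 + n)         ≡⟨ cong (2 ^_) (rearrange n z) ⟩
    2 ^ (7 * n + 2 * (3 * z))     ≤⟨ ^-monoʳ-≤ 2 (≤-trans (+-monoʳ-≤ (7 * n) (*-monoʳ-≤ 2 3z≤c)) edges≥) ⟩
    2 ^ (6 * m)                   ≡⟨ cong (2 ^_) (*-comm 6 m) ⟩
    2 ^ (m * 6)                   ≡⟨ ^-*-assoc 2 m 6 ⟨
    (2 ^ m) ^ 6                   ≤⟨ ^-monoˡ-≤ 6 count ⟩
    (2 ^ (n + z) * L) ^ 6         ≡⟨ ^-distribʳ-* 6 (2 ^ (n + z)) L ⟩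
    (2 ^ (n + z)) ^ 6 * L ^ 6     ≡⟨ cong (_* L ^ 6) (^-*-assoc 2 (n + z) 6) ⟩
    2 ^ ((n + z) * 6) * L ^ 6     ∎)

-- Counting the nowhere-zero flows with a fixed Z3-part.

module Counting (G : Graph) (P : Seymour.FlowPair G) where
  open Boundary G
  open Seymour.FlowPair P

  ψ : Fin 3 → E → Γ
  ψ k = f ⊞ (scale k ∘ F)

  Zero : Fin 3 → E → Set
  Zero k e = proj₂ (ψ k e) ≡ 0F

  Zero? : ∀ k e → Dec (Zero k e)
  Zero? k e = proj₂ (ψ k e) ≟ᶠ 0F

  ψ-flow : ∀ k v → ∂ (ψ k) v ≡ 0G
  ψ-flow k v = trans (∂-⊞ f (scale k ∘ F) v) (cong₂ _⊕_ (f-flow v)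
    (trans (∂-hom (scale k) (scale-0 k) (scale-⊕ k) F v) (trans (cong (scale k) (F-flow v)) (scale-0 k))))

  -- Where `F` vanishes, `ψ k` equals `f` and its Z3-part is nonzero; elsewhere `F` is ±`one`, whose
  -- Z2-part is 1.
  Zero⇒F-odd : ∀ k e → Zero k e → proj₁ (F e) ≡ 1F
  Zero⇒F-odd k e ψ≡0 with F-value e
  ... | inj₂ (true  , eq) = cong proj₁ eq
  ... | inj₂ (false , eq) = cong proj₁ eq
  ... | inj₁ F≡0 = contradiction
    (trans (sym (cong proj₂ (trans (cong (λ x → f e ⊕ scale k x) F≡0)
                                   (trans (cong (f e ⊕_) (scale-0 k)) (⊕-identityʳ (f e)))))) ψ≡0)
    (f-value e F≡0)

  zeros : Fin 3 → List E
  zeros k = filter (Zero? k) (allFin (m G))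

  oddEdges : ℕ
  oddEdges = ℕΣ.sum λ e → toℕ (proj₁ (F e))

  -- On an edge where `F` is nonzero the three Z3-values differ pairwise, so exactly one is zero. On
  -- any other edge all three equal that of `f`, which is nonzero.
  zeros-total : length (zeros 0F) + length (zeros 1F) + length (zeros 2F) ≤ oddEdges
  zeros-total = begin
    length (zeros 0F) + length (zeros 1F) + length (zeros 2F)
      ≡⟨ cong₂ _+_ (cong₂ _+_ (length-filter-allFin (Zero? 0F)) (length-filter-allFin (Zero? 1F)))
                   (length-filter-allFin (Zero? 2F)) ⟩
    ℕΣ.sum (z 0F) + ℕΣ.sum (z 1F) + ℕΣ.sum (z 2F)
      ≡⟨ cong (_+ ℕΣ.sum (z 2F)) (ℕΣ.∑-distrib-+ (z 0F) (z 1F)) ⟨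
    ℕΣ.sum (λ e → z 0F e + z 1F e) + ℕΣ.sum (z 2F)
      ≡⟨ ℕΣ.∑-distrib-+ (λ e → z 0F e + z 1F e) (z 2F) ⟨
    ℕΣ.sum (λ e → z 0F e + z 1F e + z 2F e)
      ≤⟨ sum-mono (λ e → pointwise (f e) (F e) (F-value e) (f-value e)) ⟩
    oddEdges ∎
    where
    open ≤-Reasoning
    vanishes : Γ → Γ → Fin 3 → ℕ
    vanishes x y k = indicator (does (proj₂ (x ⊕ scale k y) ≟ᶠ 0F))
    z : Fin 3 → E → ℕ
    z k e = vanishes (f e) (F e) k
    pointwise : ∀ x y → (y ≡ 0G ⊎ ∃ λ s → y ≡ signed s one) → (y ≡ 0G → proj₂ x ≢ 0F) →
                vanishes x y 0F + vanishes x y 1F + vanishes x y 2F ≤ toℕ (proj₁ y)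
    pointwise (_ , 0F) _ (inj₁ refl) x≢0 = contradiction refl (x≢0 refl)
    pointwise (_ , 1F) _ (inj₁ refl) _ = ≤-refl
    pointwise (_ , 2F) _ (inj₁ refl) _ = ≤-refl
    pointwise (_ , 0F) _ (inj₂ (true  , refl)) _ = ≤-refl
    pointwise (_ , 1F) _ (inj₂ (true  , refl)) _ = ≤-refl
    pointwise (_ , 2F) _ (inj₂ (true  , refl)) _ = ≤-refl
    pointwise (_ , 0F) _ (inj₂ (false , refl)) _ = ≤-refl
    pointwise (_ , 1F) _ (inj₂ (false , refl)) _ = ≤-refl
    pointwise (_ , 2F) _ (inj₂ (false , refl)) _ = ≤-refl

  Bits : Set
  Bits = Vec (Fin 2) (m G)

  embed : Bits → E → Γ
  embed x e = lookup x e , 0F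

  boundaryBit : V → Bits → Fin 2
  boundaryBit v x = proj₁ (∂ (embed x) v)

  bitAt : E → Bits → Fin 2
  bitAt e x = lookup x e

  -- Two bit vectors that agree on all of these differ by a Z2-flow that vanishes on `zeros k`.
  constraints : Fin 3 → List (Bits → Fin 2)
  constraints k = map boundaryBit (allFin (n G)) ++ map bitAt (zeros k)

  length-constraints : ∀ k → length (constraints k) ≡ n G + length (zeros k)
  length-constraints k = trans (length-++ (map _ (allFin (n G))))
    (cong₂ _+_ (trans (length-map _ (allFin (n G))) (length-tabulate id)) (length-map _ (zeros k)))

  module _ (k : Fin 3) (x₀ : Bits) where

    -- Adding the reference vector `x₀` turns `x` into a Z2-flow vanishing on `zeros k`, and adding
    -- the Z2-part of `F` makes it 1 there. The Z3-part is that of `ψ k`.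
    value : Bits → E → Γ
    value x = (embed x ⊞ embed x₀) ⊞ ((π₁ ∘ F) ⊞ (π₂ ∘ ψ k))

    assignment : Bits → Assignment G
    assignment x = Vec.tabulate (value x)

    lookup-assignment : ∀ x e → lookup (assignment x) e ≡ value x e
    lookup-assignment x = lookup∘tabulate (value x)

    assignment-injective : ∀ {x y} → assignment x ≡ assignment y → x ≡ y
    assignment-injective {x} {y} eq = begin
      x                         ≡⟨ tabulate∘lookup x ⟨
      Vec.tabulate (lookup x)   ≡⟨ tabulate-cong pointwise ⟩
      Vec.tabulate (lookup y)   ≡⟨ tabulate∘lookup y ⟩
      y                         ∎
      where
      open ≡-Reasoning
      cancel : ∀ a b c d → addMod (addMod a c) (addMod d 0F) ≡ addMod (addMod b c) (addMod d 0F) → a ≡ b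
      cancel = from-yes (all? λ a → all? λ b → all? λ c → all? λ d →
        (addMod {1} (addMod a c) (addMod d 0F) ≟ᶠ addMod (addMod b c) (addMod d 0F)) →-dec a ≟ᶠ b)
      pointwise : ∀ e → lookup x e ≡ lookup y e
      pointwise e = cancel (lookup x e) (lookup y e) (lookup x₀ e) (proj₁ (F e))
        (cong proj₁ (trans (sym (lookup-assignment x e))
                           (trans (cong (λ φ → lookup φ e) eq) (lookup-assignment y e))))

    assignment-flow : ∀ {x} → (∀ v → proj₁ (∂ (embed x) v) ≡ proj₁ (∂ (embed x₀) v)) → IsFlow G (assignment x)
    assignment-flow {x} agree = flow-criterion G (assignment x) λ v → begin
      ∂ (lookup (assignment x)) v
        ≡⟨ ∂-cong (lookup-assignment x) v ⟩
      ∂ (value x) v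
        ≡⟨ ∂-⊞ (embed x ⊞ embed x₀) ((π₁ ∘ F) ⊞ (π₂ ∘ ψ k)) v ⟩
      ∂ (embed x ⊞ embed x₀) v ⊕ ∂ ((π₁ ∘ F) ⊞ (π₂ ∘ ψ k)) v
        ≡⟨ cong₂ _⊕_ (∂-⊞ (embed x) (embed x₀) v) (∂-⊞ (π₁ ∘ F) (π₂ ∘ ψ k) v) ⟩
      (∂ (embed x) v ⊕ ∂ (embed x₀) v) ⊕ (∂ (π₁ ∘ F) v ⊕ ∂ (π₂ ∘ ψ k) v)
        ≡⟨ cong₂ _⊕_ (cong₂ _⊕_ (∂-hom π₁ refl π₁-⊕ (embed x) v) (∂-hom π₁ refl π₁-⊕ (embed x₀) v))
                     (cong₂ _⊕_ (trans (∂-hom π₁ refl π₁-⊕ F v) (cong π₁ (F-flow v)))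
                                (trans (∂-hom π₂ refl π₂-⊕ (ψ k) v) (cong π₂ (ψ-flow k v)))) ⟩
      (π₁ (∂ (embed x) v) ⊕ π₁ (∂ (embed x₀) v)) ⊕ 0G
        ≡⟨ cong (λ b → ((b , 0F) ⊕ π₁ (∂ (embed x₀) v)) ⊕ 0G) (agree v) ⟩
      (π₁ (∂ (embed x₀) v) ⊕ π₁ (∂ (embed x₀) v)) ⊕ 0G
        ≡⟨ cong (_⊕ 0G) (⊕-inverseʳ (π₁ (∂ (embed x₀) v))) ⟩
      0G ∎
      where open ≡-Reasoning

    -- A zero value puts `e` in `zeros k`. There `x` and `x₀` cancel, and the Z2-part of `F`
    -- contributes 1.
    assignment-nowhereZero : ∀ {x} → (∀ {e} → e ∈ˡ zeros k → lookup x e ≡ lookup x₀ e) →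
                             NowhereZero G (assignment x)
    assignment-nowhereZero {x} agree e φe≡0 = contradiction
      (trans (sym (first (lookup x₀ e))) (trans (sym substituted) (cong proj₁ value≡0))) λ ()
      where
      value≡0 : value x e ≡ 0G
      value≡0 = trans (sym (lookup-assignment x e)) φe≡0
      second : ∀ t → addMod {2} 0F (addMod 0F t) ≡ 0F → t ≡ 0F
      second 0F _ = refl
      second 1F ()
      second 2F ()
      zero-e : Zero k e
      zero-e = second (proj₂ (ψ k e)) (cong proj₂ value≡0)
      first : ∀ b → addMod {1} (addMod b b) (addMod 1F 0F) ≡ 1F
      first 0F = refl
      first 1F = refl
      substituted : proj₁ (value x e) ≡ addMod (addMod (lookup x₀ e) (lookup x₀ e)) (addMod 1F 0F)
      substituted = cong₂ (λ b c → addMod (addMod b (lookup x₀ e)) (addMod c 0F))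
        (agree (∈-filter⁺ (Zero? k) (∈-allFin e) zero-e)) (Zero⇒F-odd k e zero-e)

  manyFlows : ∀ k → Σ (List (Assignment G)) λ fs →
              Unique fs × All (IsNZFlow G) fs × 2 ^ m G ≤ 2 ^ (n G + length (zeros k)) * length fs
  manyFlows k with bitVectors (m G)
  ... | xs , unique , len with pigeonhole (constraints k) xs unique
  ...   | ys , unique′ , agree , bound = flows ys unique′ agree
    (subst₂ (λ a b → a ≤ 2 ^ b * length ys) len (length-constraints k) bound)
    where
    flows : ∀ ys → Unique ys → (∀ {c x y} → c ∈ˡ constraints k → x ∈ˡ ys → y ∈ˡ ys → c x ≡ c y) →
            2 ^ m G ≤ 2 ^ (n G + length (zeros k)) * length ys →
            Σ (List (Assignment G)) λ fs →
            Unique fs × All (IsNZFlow G) fs × 2 ^ m G ≤ 2 ^ (n G + length (zeros k)) * length fs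
    -- Without a reference vector the empty list of flows is returned, and the bound carries over
    -- unchanged.
    flows []            u agree le = [] , [] , [] , le
    -- The first vector of the class is the reference. It also represents its own class member, with
    -- Z2-part that of `F`.
    flows ys@(x₀ ∷ _) u agree le = map (assignment k x₀) ys
      , Uniqueₚ.map⁺ (assignment-injective k x₀) u
      , Allₚ.map⁺ (All.tabulate λ {y} y∈ →
          assignment-flow k x₀ {y} (λ v →
            agree {boundaryBit v} (∈-++⁺ˡ (∈-map⁺ boundaryBit (∈-allFin v))) y∈ (here refl))
        , assignment-nowhereZero k x₀ {y} (λ {e} e∈ →
            agree {bitAt e} (∈-++⁺ʳ (map boundaryBit (allFin (n G))) (∈-map⁺ bitAt e∈)) y∈ (here refl)))
      , subst (λ l → 2 ^ m G ≤ 2 ^ (n G + length (zeros k)) * l) (sym (length-map (assignment k x₀) ys)) le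

-- Combining the flow pair, the choice among three Z3-parts and the two counts.

theorem13 : (G : Graph) → EdgeConnected 3 G →
    Σ (List (Assignment G)) (λ fs →
      Unique fs × All (IsNZFlow G) fs × 2 ^ n G ≤ length fs ^ 7)
-- The bound 2 ≤ n, read as 1 < n, supplies vertex 1 as the root.
theorem13 G conn@(2≤n , _) with Seymour.flowPair G conn (fromℕ< 2≤n)
... | P with one-of-three (λ k → length (Counting.zeros G P k)) (Counting.oddEdges G P) (Counting.zeros-total G P)
...   | k , 3z≤c with Counting.manyFlows G P k
...     | fs , unique , nz , count = fs , unique , nz
  , exponent-bound (n G) (m G) (length (Counting.zeros G P k)) (Counting.oddEdges G P) (length fs)
      (Degrees.even-subgraph-bound G conn F F-flow) 3z≤c count
  where open Seymour.FlowPair P using (F; F-flow)
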